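{- Let $G$ be a directed acyclic graph with a unique source $s$ and a unique sink $t$, such that $G$ is max-unique, i.e. for each pair of vertices $u,v$ of $G$, if there is a path from $u$ to $v$ in $G$, then the longest path from $u$ to $v$ is unique. Then the length of the longest path from $s$ to $t$ in $G$ can be computed in $\mathrm{UL} \cap \mathrm{co\text{ - }UL}$.
   Context: Graphs are finite, directed and unweighted; the length of a path is its number of edges. A source is a vertex of in-degree $0$, a sink is a vertex of out-degree $0$. $\mathrm{UL}$ (unambiguous logspace) is the class of languages accepted by a nondeterministic logarithmic-space Turing machine that has at most one accepting computation path on every input; $\mathrm{co\text{ - }UL}$ is the class of complements of languages in $\mathrm{UL}$. That the length can be computed in $\mathrm{UL}\cap\mathrm{co\text{ - }UL}$ is understood as follows: there is a single nondeterministic logarithmic-space Turing machine which, on every input $(G,s,t)$ satisfying the hypotheses, has exactly one computation path that does not reject, and on that path outputs the length of the longest path from $s$ to $t$ in $G$ (equivalently, on instances $(G,s,t,k)$ with $(G,s,t)$ satisfying the hypotheses, deciding whether the longest path from $s$ to $t$ has length at least $k$ is in $\mathrm{UL}\cap\mathrm{co\text{ - }UL}$). -}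

module Defs where

open import Data.Bool.Base using (Bool; T)
open import Data.Digit using (Bit; fromDigits)
open import Data.Fin.Base using (Fin; toℕ)
open import Data.List.Base as List
  using (List; []; _∷_; _++_; map; replicate; allFin; filterᵇ; concat; head; drop; fromMaybe)
open import Data.List.Membership.Propositional using (_∈_)
open import Data.Maybe.Base using (Maybe; maybe)
open import Data.Nat.Base using (ℕ; zero; suc; pred; _+_; _*_; _⊓_; _≤_)
open import Data.Nat.Logarithm using (⌊log₂_⌋)
open import Data.Product using (Σ-syntax; ∃-syntax; ∃!; _×_; _,_; proj₁)
open import Data.Vec.Base as Vec using (Vec)
open import Function.Base using (flip)
open import Function.Bundles using (_↔_)
open import Induction.WellFounded using (Acc)
open import Relation.Binary.Construct.Closure.ReflexiveTransitive using (Star; fold)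
open import Relation.Binary.Construct.Closure.Transitive using (TransClosure)
open import Relation.Binary.PropositionalEquality.Core using (_≡_)
open import Relation.Nullary.Negation.Core using (¬_)

------------------------------------------------------------------------
-- Directed graphs

Digraph : ℕ → Set
Digraph n = Fin n → Fin n → Bool

module _ {n : ℕ} (G : Digraph n) where

  Edge : Fin n → Fin n → Set
  Edge u v = T (G u v)

  -- Repeated vertices are not excluded here; in an acyclic graph there
  -- are none. Proofs of T b are unique, so two paths are equal exactly
  -- when they visit the same vertices in the same order.
  Path : Fin n → Fin n → Set
  Path = Star Edge

  pathLength : ∀ {u v} → Path u v → ℕ
  pathLength = fold (λ _ _ → ℕ) (λ _ → suc) 0

  Acyclic : Set
  Acyclic = ∀ v → ¬ TransClosure Edge v v

  inDegree outDegree : Fin n → ℕ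
  inDegree  v = List.length (filterᵇ (λ u → G u v) (allFin n))
  outDegree v = List.length (filterᵇ (λ w → G v w) (allFin n))

  IsSource IsSink : Fin n → Set
  IsSource v = inDegree v ≡ 0
  IsSink   v = outDegree v ≡ 0

  IsUniqueSource IsUniqueSink : Fin n → Set
  IsUniqueSource s = IsSource s × (∀ v → IsSource v → v ≡ s)
  IsUniqueSink   t = IsSink t × (∀ v → IsSink v → v ≡ t)

  IsLongest : ∀ {u v} → Path u v → Set
  IsLongest {u} {v} p = ∀ (q : Path u v) → pathLength q ≤ pathLength p

  MaxUnique : Set
  MaxUnique = ∀ u v → Path u v → ∃! _≡_ (IsLongest {u} {v})

  IsLongestPathLength : Fin n → Fin n → ℕ → Set
  IsLongestPathLength u v d = Σ[ p ∈ Path u v ] IsLongest p × pathLength p ≡ d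

------------------------------------------------------------------------
-- Nondeterministic Turing machines with a read-only input tape,
-- two-way infinite work tapes and a write-only output tape

data Move : Set where
  left stay right : Move

-- The input word is enclosed between two end markers, which the input
-- head cannot pass.
data Scanned (A : Set) : Set where
  ⊢ ⊣ : Scanned A
  symbol : A → Scanned A

scan : ∀ {A : Set} → List A → ℕ → Scanned A
scan w zero    = ⊢
scan w (suc i) = maybe symbol ⊣ (head (drop i w))

moveInput : ∀ {A : Set} → List A → Move → ℕ → ℕ
moveInput w left  i = pred i
moveInput w stay  i = i
moveInput w right i = suc i ⊓ suc (List.length w)

-- The cells visited so far; every other cell is blank. The lists on
-- both sides start with the cell next to the head.
record Tape (Γ : Set) : Set where
  constructor tape
  field
    before : List Γ
    under  : Γ
    after  : List Γ

  visited : ℕ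
  visited = List.length before + suc (List.length after)

open Tape public

module _ {Γ : Set} (blank : Γ) where

  blankTape : Tape Γ
  blankTape = tape [] blank []

  moveTape : Move → Tape Γ → Tape Γ
  moveTape left  (tape []       x rs)       = tape []       blank (x ∷ rs)
  moveTape left  (tape (l ∷ ls) x rs)       = tape ls       l     (x ∷ rs)
  moveTape stay  t                          = t
  moveTape right (tape ls       x [])       = tape (x ∷ ls) blank []
  moveTape right (tape ls       x (r ∷ rs)) = tape (x ∷ ls) r     rs

  writeAndMove : Γ × Move → Tape Γ → Tape Γ
  writeAndMove (x , m) t = moveTape m (record t { under = x })

record Action (State A Γ B : Set) (tapes : ℕ) : Set where
  constructor action
  field
    nextState : State
    inputMove : Move
    workMoves : Vec (Γ × Move) tapes
    emit      : Maybe B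

-- A is the input alphabet, B the output alphabet.
record NTM (A B : Set) : Set₁ where
  field
    State        : Set
    stateCount   : ℕ
    State-finite : State ↔ Fin stateCount

    Γ           : Set
    symbolCount : ℕ
    Γ-finite    : Γ ↔ Fin symbolCount
    blank       : Γ

    tapes     : ℕ
    start     : State
    accepting : State → Bool
    δ         : State → Scanned A → Vec Γ tapes → List (Action State A Γ B tapes)

  record Config : Set where
    constructor config
    field
      state     : State
      inputHead : ℕ
      work      : Vec (Tape Γ) tapes
      -- The most recently written symbol comes first.
      output    : List B

  open Config public

  initial : Config
  initial = config start 0 (Vec.replicate tapes (blankTape blank)) []

  space : Config → ℕ
  space c = Vec.sum (Vec.map visited (work c))

  module _ (w : List A) where

    perform : Config → Action State A Γ B tapes → Config
    perform c (action q m ms b) = config q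
      (moveInput w m (inputHead c))
      (Vec.zipWith (writeAndMove blank) ms (work c))
      (fromMaybe b ++ output c)

    successors : Config → List Config
    successors c =
      map (perform c) (δ (state c) (scan w (inputHead c)) (Vec.map under (work c)))

    -- A proof of c ⟶ c′ records which of the available transitions is
    -- taken, so different choices count as different computation paths
    -- even when they lead to the same configuration.
    _⟶_ : Config → Config → Set
    c ⟶ c′ = c′ ∈ successors c

    Halted : Config → Set
    Halted c = successors c ≡ []

    -- The machine rejects by halting in a state that is not accepting.
    AcceptingPath : Set
    AcceptingPath =
      Σ[ c ∈ Config ] Star _⟶_ initial c × Halted c × T (accepting (state c))

    finalOutput : AcceptingPath → List B
    finalOutput p = output (proj₁ p)

    AlwaysHalts : Set
    AlwaysHalts = Acc (flip _⟶_) initial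

    -- A computation path that does not reject is either accepting or
    -- infinite; the first conjunct excludes the infinite ones.
    UnambiguouslyOutputs : (List B → Set) → Set
    UnambiguouslyOutputs P =
      AlwaysHalts ×
      (Σ[ p ∈ AcceptingPath ] (∀ q → p ≡ q) × P (finalOutput p))

  LogSpace : Set
  LogSpace = ∃[ k ] ∀ w c → Star (_⟶_ w) initial c →
    space c ≤ k * suc ⌊log₂ List.length w ⌋

------------------------------------------------------------------------
-- Encoding of instances and of results

data Symbol : Set where
  bit : Bool → Symbol
  #   : Symbol

-- 1ˢ # 1ᵗ # followed by the rows of the adjacency matrix, each
-- terminated by #.
encode : ∀ {n} → Digraph n → Fin n → Fin n → List Symbol
encode {n} G s t =
  unary s ++ unary t ++ concat (List.tabulate λ u → row u)
  where
  unary : Fin n → List Symbol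
  unary v = replicate (toℕ v) (bit Bool.true) ++ # ∷ []

  row : Fin n → List Symbol
  row u = List.tabulate (λ v → bit (G u v)) ++ # ∷ []

-- fromDigits expects the least significant bit first, and outputs are
-- stored last symbol first: the numeral is written on the output tape
-- starting with its most significant bit.
binaryValue : List Bit → ℕ
binaryValue = fromDigits

{-# OPTIONS --safe #-}
-- Let ℓ(v) be the length of the longest path from s to v. As G is
-- acyclic with the unique source s, every v is reachable from s, and
-- ℓ(v) > k exactly if some predecessor u of v has ℓ(u) ≥ k. The machine
-- first guesses S = Σ ℓ(v). It then computes c(k), the number of v with
-- ℓ(v) ≥ k, for k = 0, 1, …: given c(k), it decides for each v in turn
-- whether ℓ(v) > k by guessing a path from s to u, of length l(u) ≤ ℓ(u),
-- for every u, rejecting unless Σ l(u) = S and l(u) ≥ k for exactly c(k)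
-- vertices u. The latter ensures that l(u) ≥ k if and only if ℓ(u) ≥ k,
-- so all c(k) are correct whatever S is; in the end S is compared with
-- Σ c(k + 1), so a wrong S leads to rejection. If S is right, then all
-- l(u) = ℓ(u), and by max-uniqueness the guessed paths are determined.
-- The last k with c(k) ≠ 0 is ℓ(t), since t is the unique sink.
--
-- All registers are kept in binary on one tape, with one digit of every
-- register in each cell. Its length is that of the binary numeral of
-- the length of the input, counted once at the start; an operation on
-- registers is one sweep over this tape and back.
module Submission where

open import Defs
open import Axiom.UniquenessOfIdentityProofs.WithK using (uip)
open import Data.Bool.Base using (Bool; true; false; T; if_then_else_; not; _∧_; _xor_)
open import Data.Bool.Properties using (T?; T-≡; T-∧; T-irrelevant)
open import Data.Digit using (Bit; fromDigits)
open import Data.Empty using (⊥-elim)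
open import Data.Fin.Base using (Fin; zero; suc; toℕ; fromℕ<)
import Data.Fin as Fin
open import Data.Fin.Induction using (spo-wellFounded; spo-noetherian)
open import Data.Fin.Patterns
open import Data.Fin.Properties
  using (toℕ<n; toℕ-injective; toℕ-fromℕ<; pigeonhole; any?; 1↔⊤; 2↔Bool; +↔⊎; *↔×)
open import Data.List.Base as List
  using (List; []; _∷_; _++_; length; map; foldl; filterᵇ; allFin; concat; tabulate; fromMaybe; drop; head)
open import Data.List.Membership.Propositional using (_∈_)
open import Data.List.Membership.Propositional.Properties using (∈-map⁻)
open import Data.List.Properties
  using (++-identityʳ; ++-assoc; length-map; length-++; length-tabulate; map-id; map-∘)
open import Data.List.Relation.Unary.All using (All; []; _∷_)
open import Data.List.Relation.Unary.Any using (here; there)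
open import Data.Maybe.Base as Maybe using (Maybe; just; nothing; maybe)
open import Data.Nat.Base
open import Data.Nat.Logarithm
  using (⌊log₂_⌋; ⌊log₂⌋-mono-≤; ⌊log₂[2^n]⌋≡n; ⌊log₂[2*b]⌋≡1+⌊log₂b⌋)
open import Data.Nat.Properties hiding (_≟_)
open import Data.Nat.Solver using (module +-*-Solver)
open import Data.Product using (Σ-syntax; ∃-syntax; _×_; _,_; proj₁; proj₂; uncurry)
open import Data.Product.Function.NonDependent.Propositional using (_×-↔_)
open import Data.Sum.Base using (_⊎_; inj₁; inj₂)
open import Data.Sum.Function.Propositional using (_⊎-↔_)
open import Data.Unit.Base using (⊤; tt)
open import Data.Vec.Base using (Vec; []; _∷_; lookup; _[_]≔_; _[_]%=_; replicate; uncons)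
open import Data.Vec.Properties
  using (lookup∘updateAt; lookup∘updateAt′; lookup∘update; lookup∘update′; lookup-replicate)
open import Function.Base using (_∘_; flip; case_of_)
open import Function.Bundles using (_↔_; mk↔ₛ′; Equivalence)
open import Function.Construct.Identity using (↔-id)
open import Function.Properties.Inverse using (↔-sym; ↔-trans)
open import Induction.WellFounded using (Acc; acc; WellFounded)
open import Relation.Binary.Construct.Closure.ReflexiveTransitive using (Star; ε; _◅_; _◅◅_)
open import Relation.Binary.Construct.Closure.Transitive as Plus using (TransClosure; [_]; _∷_)
open import Relation.Binary.PropositionalEquality hiding ([_])
open import Relation.Binary.Structures using (IsStrictPartialOrder)
open import Relation.Nullary using (¬_; yes; no; does; contradiction)
open +-*-Solver using (solve; _:+_; _:*_; _:=_; con)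

-- Computation paths

-- A guessed path bounds a level from below only, and `c(k)` is what exposes underestimates at the
-- threshold `k`. Certifying unreachable vertices, the other half of inductive counting, does not
-- arise, because every vertex is reachable from `s`. The sum cannot be built up together with
-- `c(k)`, as it can for shortest paths: a path of length at least `k` to `u` is pinned down only
-- when it is a longest one, and at stage `k` its length is not yet known. Hence the sum of all
-- levels is guessed in advance. The price is the wrong guesses. Under a wrong sum many computation
-- paths may survive many rounds, and all of them must be shown to reject in the end. The whole
-- proof is therefore stated as `c ⇓ o`, where `o` says whether the sum is right, and most loops are
-- treated once for both values of `o`. Every computation path must also halt. Walks halt by
-- acyclicity, the loops over vertices by counting, and the guess of the sum because the registers
-- have a fixed width and an overflow rejects. That width suffices on the accepting path: all sums
-- are at most `n * n`, and the adjacency matrix alone makes the input that long.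

module Outcome {A B : Set} (M : NTM A B) (w : List A) (P : List B → Set) where

  open NTM M

  Run : Config → Set
  Run c = Σ[ c′ ∈ Config ] Star (_⟶_ w) c c′ × Halted w c′ × T (accepting (state c′))

  -- The membership proof tells apart two transitions that lead to the same configuration, so that
  -- uniqueness below counts choices and not just configurations.
  RunVia : List Config → Set
  RunVia cs = Σ[ c ∈ Config ] c ∈ cs × Run c

  OnlyOne : {X : Set} → (X → Config) → Set
  OnlyOne {X} end = Σ[ p ∈ X ] (∀ q → p ≡ q) × P (output (end p))

  -- For b = false every computation path from c rejects, for b = true
  -- exactly one does not.
  infix 4 _⇓_
  _⇓_ : Config → Bool → Set
  c ⇓ b = Acc (λ y x → _⟶_ w x y) c
        × (if b then OnlyOne {Run c} proj₁ else ¬ Run c)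

  private
    end : ∀ {cs} → RunVia cs → Config
    end (_ , _ , p) = proj₁ p

    _⇊_ : List Config → Bool → Set
    cs ⇊ b = (∀ {c} → c ∈ cs → Acc (λ y x → _⟶_ w x y) c)
           × (if b then OnlyOne {RunVia cs} end else ¬ RunVia cs)

    prepend : ∀ {c} → RunVia (successors w c) → Run c
    prepend (_ , m , c′ , p , h , a) = c′ , m ◅ p , h , a

    first : ∀ {c} → ¬ Halted w c → (p : Run c) → Σ[ q ∈ RunVia (successors w c) ] prepend q ≡ p
    first live (_ , ε , h , _)      = ⊥-elim (live h)
    first live (c′ , m ◅ p , h , a) = (_ , m , c′ , p , h , a) , refl

    branch : ∀ {c} b → ¬ Halted w c → successors w c ⇊ b → c ⇓ b
    branch false live (r , s) = acc r , λ p → s (proj₁ (first live p))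
    branch true  live (r , p , uniq , h) = acc r , prepend p , uniq′ , h
      where
      uniq′ : ∀ q → prepend p ≡ q
      uniq′ q with first live q
      ... | q′ , refl = cong prepend (uniq q′)

    branch-≡ : ∀ {c x xs} b → successors w c ≡ x ∷ xs → (x ∷ xs) ⇊ b → c ⇓ b
    branch-≡ b eq r = branch b (λ h → case trans (sym eq) h of λ ()) (subst (_⇊ b) (sym eq) r)

  one : ∀ {c c₁ b} → successors w c ≡ c₁ ∷ [] → c₁ ⇓ b → c ⇓ b
  one {b = false} eq (r , s) = branch-≡ false eq
    ((λ where (here refl) → r) , λ where (_ , here refl , p) → s p)
  one {b = true} eq (r , p , uniq , h) = branch-≡ true eq
    ((λ where (here refl) → r) , (_ , here refl , p) ,
     (λ where (_ , here refl , q) → cong (λ q → _ , here refl , q) (uniq q)) , h)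

  fork-false : ∀ {c c₁ c₂} → successors w c ≡ c₁ ∷ c₂ ∷ [] → c₁ ⇓ false → c₂ ⇓ false → c ⇓ false
  fork-false eq (r₁ , s₁) (r₂ , s₂) = branch-≡ false eq
    ((λ where (here refl) → r₁
              (there (here refl)) → r₂) ,
      λ where (_ , here refl , p) → s₁ p
              (_ , there (here refl) , p) → s₂ p)

  fork-left : ∀ {c c₁ c₂} → successors w c ≡ c₁ ∷ c₂ ∷ [] → c₁ ⇓ true → c₂ ⇓ false → c ⇓ true
  fork-left eq (r₁ , p , uniq , h) (r₂ , s₂) = branch-≡ true eq
    ((λ where (here refl) → r₁
              (there (here refl)) → r₂) ,
     (_ , here refl , p) ,
     (λ where (_ , here refl , q) → cong (λ q → _ , here refl , q) (uniq q)
              (_ , there (here refl) , q) → ⊥-elim (s₂ q)) , h)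

  fork-right : ∀ {c c₁ c₂} → successors w c ≡ c₁ ∷ c₂ ∷ [] → c₁ ⇓ false → c₂ ⇓ true → c ⇓ true
  fork-right eq (r₁ , s₁) (r₂ , p , uniq , h) = branch-≡ true eq
    ((λ where (here refl) → r₁
              (there (here refl)) → r₂) ,
     (_ , there (here refl) , p) ,
     (λ where (_ , here refl , q) → ⊥-elim (s₁ q)
              (_ , there (here refl) , q) → cong (λ q → _ , there (here refl) , q) (uniq q)) , h)

  private
    ∉-[] : ∀ {c c′} → successors w c ≡ [] → ¬ c′ ∈ successors w c
    ∉-[] eq m = case subst (_ ∈_) eq m of λ ()

  reject : ∀ {c} → successors w c ≡ [] → accepting (state c) ≡ false → c ⇓ false
  reject eq f = acc (λ m → ⊥-elim (∉-[] eq m)) , λ where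
    (_ , ε , _ , a) → subst T f a
    (_ , m ◅ _ , _) → ∉-[] eq m

  accept : ∀ {c} → successors w c ≡ [] → T (accepting (state c)) → P (output c) → c ⇓ true
  accept {c} eq a₀ h = acc (λ m → ⊥-elim (∉-[] eq m)) , (c , ε , eq , a₀) , (λ where
    -- The proof of halting is a component of an accepting path, so uniqueness of the path includes
    -- uniqueness of this identity proof.
    (_ , ε , e , a) → cong₂ (λ e a → c , ε , e , a) (uip eq e) (T-irrelevant a₀ a)
    (_ , m ◅ _ , _) → ⊥-elim (∉-[] eq m)) , h

-- Numbers in binary

digit : Bool → ℕ
digit b = if b then 1 else 0

digit≤1 : ∀ b → digit b ≤ 1
digit≤1 false = z≤n
digit≤1 true  = ≤-refl

full-adder : ∀ c b x → digit (c xor b) + 2 * (digit (c ∧ b) + x) ≡ digit c + (digit b + 2 * x)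
full-adder false false x = refl
full-adder false true  x = refl
full-adder true  false x = refl
full-adder true  true  x = cong suc (+-suc x (x + 0))

bits-injective : ∀ a b {x y} → digit a + 2 * x ≡ digit b + 2 * y → a ≡ b × x ≡ y
bits-injective false false {x} {y} e = refl , *-cancelˡ-≡ x y 2 e
bits-injective false true {x} {y} e = ⊥-elim (even≢odd x y e)
bits-injective true false {x} {y} e = ⊥-elim (even≢odd y x (sym e))
bits-injective true true {x} {y} e = refl , *-cancelˡ-≡ x y 2 (suc-injective e)

-- Digits arrive least significant first, so a differing pair overrides the verdict on all lower
-- digits, and an equal pair keeps it.
le-carry : Bool → Bool → Bool → Bool
le-carry a b c = if a xor b then b else c

-- This bound and the next are the one-digit steps of `le-true` and `le-false`: they are added to
-- twice the inequality for the higher digits.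
le-carry-upper : ∀ a b c → digit a + 2 * digit (le-carry a b c) ≤ 1 + (digit c + digit b)
le-carry-upper false false false = z≤n
le-carry-upper false false true  = ≤-refl
le-carry-upper false true  c     = s≤s (m≤n+m 1 (digit c))
le-carry-upper true  false c     = s≤s z≤n
le-carry-upper true  true  false = s≤s z≤n
le-carry-upper true  true  true  = ≤-refl

le-carry-lower : ∀ a b c → digit c + digit b ≤ digit a + 2 * digit (le-carry a b c)
le-carry-lower false false false = z≤n
le-carry-lower false false true  = s≤s z≤n
le-carry-lower false true  false = s≤s z≤n
le-carry-lower false true  true  = ≤-refl
le-carry-lower true  false false = z≤n
le-carry-lower true  false true  = ≤-refl
le-carry-lower true  true  false = ≤-refl
le-carry-lower true  true  true  = s≤s (s≤s z≤n)

data Op (R : ℕ) : Set where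
  inc   : Fin R → Op R
  copy  : List (Fin R × Fin R) → Op R
  eq le : Fin R → Fin R → Op R
  print : Fin R → Op R

module _ {R : ℕ} where

  -- Polymorphic, so that the same assignments act on a column of digits and on the vector of
  -- register values.
  copyAll : {A : Set} → List (Fin R × Fin R) → Vec A R → Vec A R
  copyAll ps v = foldl (λ v (i , j) → v [ i ]≔ lookup v j) v ps

  -- The final carry also selects the exit of a sweep: `copy` and `print` keep `false` and always
  -- leave by `otherwise`, whereas `true` means overflow after `inc` and success after a comparison.
  carryIn : Op R → Bool
  carryIn (inc _)   = true
  carryIn (copy _)  = false
  carryIn (eq _ _)  = true
  carryIn (le _ _)  = true
  carryIn (print _) = false

  step : Op R → Bool → Vec Bool R → Bool × Vec Bool R
  step (inc i)   c d = c ∧ lookup d i , d [ i ]%= (c xor_)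
  step (copy ps) c d = c , copyAll ps d
  step (eq i j)  c d = c ∧ not (lookup d i xor lookup d j) , d
  step (le i j)  c d = (if lookup d i xor lookup d j then lookup d j else c) , d
  step (print _) c d = c , d

  run : Op R → Bool → List (Vec Bool R) → Bool × List (Vec Bool R)
  run op c []       = c , []
  run op c (d ∷ ds) =
    let (c₁ , d₁) = step op c d ; (c₂ , ds₂) = run op c₁ ds in c₂ , d₁ ∷ ds₂

  length-run : ∀ op c ds → length (proj₂ (run op c ds)) ≡ length ds
  length-run op c []       = refl
  length-run op c (d ∷ ds) = cong suc (length-run op _ ds)

  value : Fin R → List (Vec Bool R) → ℕ
  value i []       = 0
  value i (d ∷ ds) = digit (lookup d i) + 2 * value i ds

  value< : ∀ i ds → value i ds < 2 ^ length ds
  value< i []       = s≤s z≤n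
  value< i (d ∷ ds) = begin-strict
    digit (lookup d i) + 2 * value i ds ≤⟨ +-monoˡ-≤ _ (digit≤1 (lookup d i)) ⟩
    1 + 2 * value i ds                <⟨ n<1+n _ ⟩
    2 + 2 * value i ds                ≡⟨ sym (*-suc 2 (value i ds)) ⟩
    2 * suc (value i ds)              ≤⟨ *-monoʳ-≤ 2 (value< i ds) ⟩
    2 * 2 ^ length ds                 ∎
    where open ≤-Reasoning

  value-++ : ∀ i ds es → value i (ds ++ es) ≡ value i ds + 2 ^ length ds * value i es
  value-++ i []       es = sym (+-identityʳ _)
  value-++ i (d ∷ ds) es rewrite value-++ i ds es =
    solve 4 (λ b v p e → b :+ con 2 :* (v :+ p :* e) := (b :+ con 2 :* v) :+ (con 2 :* p) :* e) refl
      (digit (lookup d i)) (value i ds) (2 ^ length ds) (value i es)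

  Represents : List (Vec Bool R) → Vec ℕ R → Set
  Represents ds ρ = ∀ i → value i ds ≡ lookup ρ i

  -- The outgoing carry is a digit of weight `2 ^ length ds`, which makes the equation exact even on
  -- overflow. The rules for incrementing with and without overflow and the growth of the clock are
  -- all read off from it.
  inc-value : ∀ i c ds → let (c′ , ds′) = run (inc i) c ds in
    value i ds′ + 2 ^ length ds * digit c′ ≡ digit c + value i ds
  inc-value i c []       = trans (+-identityʳ _) (sym (+-identityʳ _))
  inc-value i c (d ∷ ds) rewrite lookup∘updateAt i {c xor_} d = begin
    (digit (c xor b) + 2 * v) + 2 * p * e ≡⟨ solve 4 (λ b v p e → (b :+ con 2 :* v) :+ (con 2 :* p) :* e := b :+ con 2 :* (v :+ p :* e)) refl (digit (c xor b)) v p e ⟩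
    digit (c xor b) + 2 * (v + p * e)     ≡⟨ cong (λ z → digit (c xor b) + 2 * z) (inc-value i (c ∧ b) ds) ⟩
    digit (c xor b) + 2 * (digit (c ∧ b) + value i ds) ≡⟨ full-adder c b (value i ds) ⟩
    digit c + (digit b + 2 * value i ds) ∎
    where
    open ≡-Reasoning
    b = lookup d i
    v = value i (proj₂ (run (inc i) (c ∧ b) ds))
    p = 2 ^ length ds
    e = digit (proj₁ (run (inc i) (c ∧ b) ds))

  inc-value-other : ∀ {i j} c ds → j ≢ i → value j (proj₂ (run (inc i) c ds)) ≡ value j ds
  inc-value-other c []       j≢i = refl
  inc-value-other {i} {j} c (d ∷ ds) j≢i
    rewrite lookup∘updateAt′ j i {c xor_} j≢i d = cong (λ z → digit (lookup d j) + 2 * z) (inc-value-other (c ∧ lookup d i) ds j≢i)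

  inc-represents : ∀ {i ds ρ} → Represents ds ρ → proj₁ (run (inc i) true ds) ≡ false →
    Represents (proj₂ (run (inc i) true ds)) (ρ [ i ]%= suc)
  inc-represents {i} {ds} {ρ} rep no-carry j with j Fin.≟ i
  ... | no j≢i = trans (inc-value-other true ds j≢i) (trans (rep j) (sym (lookup∘updateAt′ j i j≢i ρ)))
  ... | yes refl = begin
    v                               ≡⟨ sym (+-identityʳ v) ⟩
    v + 0                           ≡⟨ cong (v +_) (sym (*-zeroʳ (2 ^ length ds))) ⟩
    v + 2 ^ length ds * 0           ≡⟨ cong (λ c → v + 2 ^ length ds * digit c) (sym no-carry) ⟩
    v + 2 ^ length ds * digit (proj₁ (run (inc i) true ds)) ≡⟨ inc-value i true ds ⟩
    suc (value i ds)                ≡⟨ cong suc (rep i) ⟩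
    suc (lookup ρ i)                ≡⟨ sym (lookup∘updateAt i ρ) ⟩
    lookup (ρ [ i ]%= suc) i        ∎
    where
    open ≡-Reasoning
    v = value i (proj₂ (run (inc i) true ds))

  inc-overflow : ∀ {i ds ρ} → Represents ds ρ → proj₁ (run (inc i) true ds) ≡ true →
    2 ^ length ds ≤ suc (lookup ρ i)
  inc-overflow {i} {ds} {ρ} rep carry = begin
    2 ^ length ds                    ≡⟨ sym (*-identityʳ _) ⟩
    2 ^ length ds * 1                ≡⟨ cong (λ c → 2 ^ length ds * digit c) (sym carry) ⟩
    2 ^ length ds * digit (proj₁ (run (inc i) true ds)) ≤⟨ m≤n+m _ _ ⟩
    value i (proj₂ (run (inc i) true ds)) + 2 ^ length ds * digit (proj₁ (run (inc i) true ds)) ≡⟨ inc-value i true ds ⟩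
    suc (value i ds)                 ≡⟨ cong suc (rep i) ⟩
    suc (lookup ρ i)                 ∎
    where open ≤-Reasoning

  copy-value : ∀ i j k ds → value k (map (λ d → d [ i ]≔ lookup d j) ds) ≡
    (if does (k Fin.≟ i) then value j ds else value k ds)
  copy-value i j k [] with does (k Fin.≟ i)
  ... | true = refl
  ... | false = refl
  copy-value i j k (d ∷ ds) rewrite copy-value i j k ds with k Fin.≟ i
  ... | yes refl = cong (λ b → digit b + 2 * value j ds) (lookup∘update i d _)
  ... | no k≢i = cong (λ b → digit b + 2 * value k ds) (lookup∘update′ k≢i d _)

  copyAll-represents : ∀ ps {ds ρ} → Represents ds ρ → Represents (map (copyAll ps) ds) (copyAll ps ρ)
  copyAll-represents [] {ds} rep i = trans (cong (value i) (map-id ds)) (rep i)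
  copyAll-represents ((i , j) ∷ ps) {ds} {ρ} rep k =
    trans (cong (value k) (map-∘ ds)) (copyAll-represents ps {map one ds} one-represents k)
    where
    one : {A : Set} → Vec A R → Vec A R
    one v = v [ i ]≔ lookup v j

    one-represents : Represents (map one ds) (one ρ)
    one-represents k rewrite copy-value i j k ds with k Fin.≟ i
    ... | yes refl = trans (rep j) (sym (lookup∘update i ρ _))
    ... | no k≢i = trans (rep k) (sym (lookup∘update′ k≢i ρ _))

  run-copy : ∀ ps c ds → run (copy ps) c ds ≡ (c , map (copyAll ps) ds)
  run-copy ps c []       = refl
  run-copy ps c (d ∷ ds) = cong (λ (c , ds) → c , copyAll ps d ∷ ds) (run-copy ps c ds)

  run-eq : ∀ i j c ds → proj₂ (run (eq i j) c ds) ≡ ds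
  run-eq i j c []       = refl
  run-eq i j c (d ∷ ds) = cong (d ∷_) (run-eq i j _ ds)

  run-le : ∀ i j c ds → proj₂ (run (le i j) c ds) ≡ ds
  run-le i j c []       = refl
  run-le i j c (d ∷ ds) = cong (d ∷_) (run-le i j _ ds)

  run-print : ∀ i c ds → run (print i) c ds ≡ (c , ds)
  run-print i c []       = refl
  run-print i c (d ∷ ds) = cong (λ (c , ds) → c , d ∷ ds) (run-print i c ds)

  eq-stuck : ∀ i j ds → proj₁ (run (eq i j) false ds) ≡ false
  eq-stuck i j []       = refl
  eq-stuck i j (d ∷ ds) = eq-stuck i j ds

  eq-true : ∀ i j ds → proj₁ (run (eq i j) true ds) ≡ true → value i ds ≡ value j ds
  eq-true i j []       _ = refl
  eq-true i j (d ∷ ds) e with lookup d i | lookup d j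
  ... | false | false = cong (2 *_) (eq-true i j ds e)
  ... | true  | true  = cong (λ v → suc (2 * v)) (eq-true i j ds e)
  ... | false | true  with () ← trans (sym e) (eq-stuck i j ds)
  ... | true  | false with () ← trans (sym e) (eq-stuck i j ds)

  eq-false : ∀ i j ds → proj₁ (run (eq i j) true ds) ≡ false → value i ds ≢ value j ds
  eq-false i j (d ∷ ds) e v with lookup d i | lookup d j
  ... | false | false = eq-false i j ds e (proj₂ (bits-injective false false {value i ds} {value j ds} v))
  ... | true  | true  = eq-false i j ds e (proj₂ (bits-injective true true {value i ds} {value j ds} v))
  ... | false | true  with () ← proj₁ (bits-injective false true {value i ds} {value j ds} v)
  ... | true  | false with () ← proj₁ (bits-injective true false {value i ds} {value j ds} v)

  -- The incoming carry c says whether the lower digits already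
  -- examined compare as ≤.
  le-true : ∀ i j c ds → proj₁ (run (le i j) c ds) ≡ true → value i ds < digit c + value j ds
  le-true i j true []       _ = s≤s z≤n
  le-true i j c (d ∷ ds) e = s≤s⁻¹ (begin
    2 + (a + 2 * x)            ≡⟨ solve 2 (λ a x → con 2 :+ (a :+ con 2 :* x) := a :+ con 2 :* (con 1 :+ x)) refl a x ⟩
    a + 2 * suc x              ≤⟨ +-monoʳ-≤ a (*-monoʳ-≤ 2 (le-true i j _ ds e)) ⟩
    a + 2 * (c′ + y)           ≡⟨ solve 3 (λ a c y → a :+ con 2 :* (c :+ y) := (a :+ con 2 :* c) :+ con 2 :* y) refl a c′ y ⟩
    (a + 2 * c′) + 2 * y       ≤⟨ +-monoˡ-≤ (2 * y) (le-carry-upper (lookup d i) (lookup d j) c) ⟩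
    1 + (digit c + b) + 2 * y    ≡⟨ cong suc (+-assoc (digit c) b (2 * y)) ⟩
    1 + (digit c + (b + 2 * y))  ∎)
    where
    open ≤-Reasoning
    a = digit (lookup d i)
    b = digit (lookup d j)
    x = value i ds
    y = value j ds
    c′ = digit (le-carry (lookup d i) (lookup d j) c)

  le-false : ∀ i j c ds → proj₁ (run (le i j) c ds) ≡ false → digit c + value j ds ≤ value i ds
  le-false i j false []       _ = z≤n
  le-false i j c (d ∷ ds) e = begin
    digit c + (b + 2 * y)    ≡⟨ sym (+-assoc (digit c) b (2 * y)) ⟩
    (digit c + b) + 2 * y    ≤⟨ +-monoˡ-≤ (2 * y) (le-carry-lower (lookup d i) (lookup d j) c) ⟩
    (a + 2 * c′) + 2 * y   ≡⟨ solve 3 (λ a c y → (a :+ con 2 :* c) :+ con 2 :* y := a :+ con 2 :* (c :+ y)) refl a c′ y ⟩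
    a + 2 * (c′ + y)       ≤⟨ +-monoʳ-≤ a (*-monoʳ-≤ 2 (le-false i j _ ds e)) ⟩
    a + 2 * x              ∎
    where
    open ≤-Reasoning
    a = digit (lookup d i)
    b = digit (lookup d j)
    x = value i ds
    y = value j ds
    c′ = digit (le-carry (lookup d i) (lookup d j) c)

-- The 3 is the logarithm of 8, as `3 + 2 * n ≤ 8 * n` for positive `n`. For `n = 0` the right side
-- of that inequality vanishes, hence the separate case.
log-width : ∀ L n → 2 ^ L ≤ 3 + 2 * n → L ≤ 3 + ⌊log₂ n ⌋
log-width L zero    h = ≤-trans (≤-reflexive (sym (⌊log₂[2^n]⌋≡n L))) (≤-trans (⌊log₂⌋-mono-≤ h) (s≤s z≤n))
log-width L n@(suc m) h = begin
  L                          ≡⟨ sym (⌊log₂[2^n]⌋≡n L) ⟩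
  ⌊log₂ 2 ^ L ⌋              ≤⟨ ⌊log₂⌋-mono-≤ h ⟩
  ⌊log₂ (3 + 2 * n) ⌋        ≤⟨ ⌊log₂⌋-mono-≤ le8 ⟩
  ⌊log₂ (2 * (2 * (2 * n))) ⌋ ≡⟨ ⌊log₂[2*b]⌋≡1+⌊log₂b⌋ (2 * (2 * n)) ⟩
  1 + ⌊log₂ (2 * (2 * n)) ⌋  ≡⟨ cong suc (⌊log₂[2*b]⌋≡1+⌊log₂b⌋ (2 * n)) ⟩
  2 + ⌊log₂ (2 * n) ⌋        ≡⟨ cong (2 +_) (⌊log₂[2*b]⌋≡1+⌊log₂b⌋ n) ⟩
  3 + ⌊log₂ n ⌋              ∎
  where
  open ≤-Reasoning
  le8 : 3 + 2 * n ≤ 2 * (2 * (2 * n))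
  le8 = ≤-trans (m≤n+m (3 + 2 * n) (3 + 6 * m))
    (≤-reflexive (solve 1 (λ m → (con 3 :+ con 6 :* m) :+ (con 3 :+ con 2 :* (con 1 :+ m)) := con 2 :* (con 2 :* (con 2 :* (con 1 :+ m)))) refl m))

-- The machine

-- An instruction consults either the input or the registers. The work head thus rests on `home`
-- between instructions, and only sweeps move it.
data Instr (A Lab : Set) (R : ℕ) : Set where
  branch : (Scanned A → List (Move × Lab)) → Instr A Lab R
  sweep  : Op R → (ifCarry otherwise : Maybe Lab) → Instr A Lab R
  halt   : Instr A Lab R

bits-finite : ∀ n → Vec Bool n ↔ Fin (2 ^ n)
bits-finite zero    = ↔-trans (mk↔ₛ′ (λ _ → tt) (λ _ → []) (λ _ → refl) (λ where [] → refl)) (↔-sym 1↔⊤)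
bits-finite (suc n) = ↔-trans
  (mk↔ₛ′ uncons (uncurry _∷_) (λ (b , v) → refl) (λ where (b ∷ v) → refl))
  (↔-trans (↔-sym 2↔Bool ×-↔ bits-finite n) (↔-sym *↔×))

-- The registers are kept least significant digit first between home and
-- a blank, one digit of each register per cell.
data Cell (R : ℕ) : Set where
  home blank : Cell R
  dig : Vec Bool R → Cell R

Cell-finite : ∀ R → Cell R ↔ Fin (2 + 2 ^ R)
Cell-finite R = ↔-trans
  (mk↔ₛ′
    (λ where home    → inj₁ true
             blank   → inj₁ false
             (dig d) → inj₂ d)
    (λ where (inj₁ true)  → home
             (inj₁ false) → blank
             (inj₂ d)     → dig d)
    (λ where (inj₁ true)  → refl
             (inj₁ false) → refl
             (inj₂ d)     → refl)
    (λ where home    → refl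
             blank   → refl
             (dig d) → refl))
  (↔-trans (↔-sym 2↔Bool ⊎-↔ bits-finite R) (↔-sym +↔⊎))

-- `clock` is the register in which the input length is counted before the program starts; the
-- program may reuse it afterwards.
module Machine {A Lab : Set} {K R : ℕ} (Lab-finite : Lab ↔ Fin K)
  (prog : Lab → Instr A Lab R) (first : Lab) (clock : Fin R) where

  data State : Set where
    boot count : State
    at         : Lab → State
    -- A sweep over the digits serves either the initial count (nothing)
    -- or an instruction.
    fwd bwd    : Maybe Lab → Bool → State

  State-finite : State ↔ Fin ((2 + K) + 2 * (2 * (1 + K)))
  State-finite = ↔-trans code↔ (↔-trans
    (↔-trans (↔-sym 2↔Bool ⊎-↔ Lab-finite) (↔-sym +↔⊎)
      ⊎-↔ ↔-trans (↔-sym 2↔Bool ×-↔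
             ↔-trans (↔-sym 2↔Bool ×-↔ ↔-trans (↔-sym 1↔⊤ ⊎-↔ Lab-finite) (↔-sym +↔⊎)) (↔-sym *↔×))
           (↔-sym *↔×))
    (↔-sym +↔⊎))
    where
    Code : Set
    Code = (Bool ⊎ Lab) ⊎ (Bool × Bool × (⊤ ⊎ Lab))

    to : State → Code
    to boot             = inj₁ (inj₁ false)
    to count            = inj₁ (inj₁ true)
    to (at q)           = inj₁ (inj₂ q)
    to (fwd nothing b)  = inj₂ (false , b , inj₁ tt)
    to (fwd (just q) b) = inj₂ (false , b , inj₂ q)
    to (bwd nothing b)  = inj₂ (true , b , inj₁ tt)
    to (bwd (just q) b) = inj₂ (true , b , inj₂ q)

    from : Code → State
    from (inj₁ (inj₁ false))          = boot
    from (inj₁ (inj₁ true))           = count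
    from (inj₁ (inj₂ q))              = at q
    from (inj₂ (false , b , inj₁ tt)) = fwd nothing b
    from (inj₂ (false , b , inj₂ q))  = fwd (just q) b
    from (inj₂ (true , b , inj₁ tt))  = bwd nothing b
    from (inj₂ (true , b , inj₂ q))   = bwd (just q) b

    code↔ : State ↔ Code
    code↔ = mk↔ₛ′ to from
      (λ where (inj₁ (inj₁ false)) → refl
               (inj₁ (inj₁ true)) → refl
               (inj₁ (inj₂ q)) → refl
               (inj₂ (false , b , inj₁ tt)) → refl
               (inj₂ (false , b , inj₂ q)) → refl
               (inj₂ (true , b , inj₁ tt)) → refl
               (inj₂ (true , b , inj₂ q)) → refl)
      (λ where boot → refl
               count → refl
               (at q) → refl
               (fwd nothing b) → refl
               (fwd (just q) b) → refl
               (bwd nothing b) → refl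
               (bwd (just q) b) → refl)

  Act : Set
  Act = Action State A (Cell R) Bit 1

  instrOp : Instr A Lab R → Op R
  instrOp (sweep op _ _) = op
  instrOp _              = copy []

  operation : Maybe Lab → Op R
  operation nothing  = inc clock
  operation (just q) = instrOp (prog q)

  target : Instr A Lab R → Bool → Maybe Lab
  target (sweep _ y n) b = if b then y else n
  target _             _ = nothing

  next : Maybe Lab → Bool → Maybe State
  next nothing  _ = just count
  next (just q) b = Maybe.map at (target (prog q) b)

  clockDigit : Vec Bool R
  clockDigit = replicate R false [ clock ]≔ true

  -- The one place where the digits become more: a carry out of the initial count is written as a
  -- new leading digit. A carry out of an instruction leaves the width as it is.
  writeEnd : Maybe Lab → Bool → Cell R × Move
  writeEnd nothing true = dig clockDigit , right
  writeEnd _       _    = blank , stay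

  -- Digits are emitted on the way back to home, so the most significant
  -- one comes first.
  emission : Op R → Vec Bool R → Maybe Bit
  emission (print i) d = just (if lookup d i then suc zero else zero)
  emission _         _ = nothing

  execute : Instr A Lab R → Lab → Scanned A → Cell R → List Act
  execute (branch f)     q a γ = map (λ (m , q′) → action (at q′) m ((γ , stay) ∷ []) nothing) (f a)
  execute (sweep op _ _) q a γ = action (fwd (just q) (carryIn op)) stay ((γ , right) ∷ []) nothing ∷ []
  execute halt           q a γ = []

  leave : Maybe State → List Act
  leave nothing  = []
  leave (just q) = action q stay ((home , stay) ∷ []) nothing ∷ []

  -- The left end marker is counted as well, so the clock ends at `suc (length w)`.
  onInput : Scanned A → Cell R → Act
  onInput ⊣ γ = action (at first) stay ((γ , stay) ∷ []) nothing
  onInput _ γ = action (fwd nothing true) right ((γ , right) ∷ []) nothing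

  delta : State → Scanned A → Cell R → List Act
  delta boot      _ _       = action (bwd nothing false) stay ((home , right) ∷ []) nothing ∷ []
  delta count     a γ       = onInput a γ ∷ []
  delta (at q)    a γ       = execute (prog q) q a γ
  delta (fwd t b) _ (dig d) =
    let (b′ , d′) = step (operation t) b d
    in action (fwd t b′) stay ((dig d′ , right) ∷ []) nothing ∷ []
  delta (fwd t b) _ blank   = action (bwd t b) stay (writeEnd t b ∷ []) nothing ∷ []
  delta (fwd t b) _ home    = []
  delta (bwd t b) _ (dig d) = action (bwd t b) stay ((dig d , left) ∷ []) (emission (operation t) d) ∷ []
  delta (bwd t b) _ blank   = action (bwd t b) stay ((blank , left) ∷ []) nothing ∷ []
  delta (bwd t b) _ home    = leave (next t b)

  halts : Instr A Lab R → Bool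
  halts halt = true
  halts _    = false

  accepts : State → Bool
  accepts (at q) = halts (prog q)
  accepts _      = false

  machine : NTM A Bit
  machine = record
    { State        = State
    ; stateCount   = _
    ; State-finite = State-finite
    ; Γ            = Cell R
    ; symbolCount  = _
    ; Γ-finite     = Cell-finite R
    ; blank        = blank
    ; tapes        = 1
    ; start        = boot
    ; accepting    = accepts
    ; δ            = λ where q a (γ ∷ []) → delta q a γ
    }

  open NTM machine using (Config; config; initial; successors; space; LogSpace; _⟶_)

  focus : List (Cell R) → List (Cell R) → Tape (Cell R)
  focus ls []       = tape ls blank []
  focus ls (x ∷ rs) = tape ls x rs

  moveTape-right : ∀ ls x rs → moveTape blank right (tape ls x rs) ≡ focus (x ∷ ls) rs
  moveTape-right ls x []       = refl
  moveTape-right ls x (r ∷ rs) = refl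

  cells : List (Vec Bool R) → List (Cell R)
  cells ds = map dig ds ++ blank ∷ []

  homeTape : List (Vec Bool R) → Tape (Cell R)
  homeTape ds = tape [] home (cells ds)

  value-clockDigit : value clock (clockDigit ∷ []) ≡ 1
  value-clockDigit = cong (λ b → digit b + 0) (lookup∘update clock (replicate R false) true)

  scan-⊣ : ∀ (v : List A) → scan v (suc (length v)) ≡ ⊣
  scan-⊣ []      = refl
  scan-⊣ (_ ∷ v) = scan-⊣ v

  scan-symbol : ∀ (v : List A) i → i < length v → ∃[ a ] scan v (suc i) ≡ symbol a
  scan-symbol (a ∷ v) zero    i<n = a , refl
  scan-symbol (a ∷ v) (suc i) i<n = scan-symbol v i (s≤s⁻¹ i<n)

  onInput-inside : ∀ (w : List A) i γ → i < suc (length w) →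
    onInput (scan w i) γ ≡ action (fwd nothing true) right ((γ , right) ∷ []) nothing
  onInput-inside w zero    γ _   = refl
  onInput-inside w (suc i) γ i<n rewrite proj₂ (scan-symbol w i (s≤s⁻¹ i<n)) = refl

  -- Proof rules for single instructions.

  module Rules (w : List A) (P : List Bit → Set) where

    open Outcome machine w P

    grown : Maybe Lab → Bool → List (Vec Bool R)
    grown nothing true = clockDigit ∷ []
    grown _       _    = []

    emitted : Op R → List (Vec Bool R) → List Bit → List Bit
    emitted op []       out = out
    emitted op (d ∷ ds) out = fromMaybe (emission op d) ++ emitted op ds out

    private
      sweepResult : Maybe Lab → Bool → List (Vec Bool R) → Bool × List (Vec Bool R)
      sweepResult t b ds = let (c , es) = run (operation t) b ds in c , es ++ grown t c

    -- Both directions of a sweep are handled in one induction: the digit written on the way out is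
    -- the one crossed on the way back, so the two passes nest like brackets around the remaining
    -- digits.
    sweep-back : ∀ t b ds {h l ls out o} →
      let (c , es) = sweepResult t b ds in
      config (bwd t c) h (tape ls l (cells es) ∷ []) (emitted (operation t) es out) ⇓ o →
      config (fwd t b) h (focus (l ∷ ls) (cells ds) ∷ []) out ⇓ o
    sweep-back nothing  true  [] k = one refl (one refl (one refl k))
    sweep-back nothing  false [] k = one refl (one refl k)
    sweep-back (just _) b     [] k = one refl (one refl k)
    sweep-back t b (d ∷ ds) {h} {l} {ls} {out} {o} k =
      one refl (subst (λ τ → config (fwd t b₁) h (τ ∷ []) out ⇓ o)
        (sym (moveTape-right (l ∷ ls) (dig d₁) (cells ds)))
        (sweep-back t b₁ ds (one refl k)))
      where
      b₁ = proj₁ (step (operation t) b d)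
      d₁ = proj₂ (step (operation t) b d)

    -- The registers ρ are stored in L digits each.
    record At (L : ℕ) (q : Lab) (h : ℕ) (ρ : Vec ℕ R) (o : Bool) : Set where
      field
        elim : ∀ ds → length ds ≡ L → Represents ds ρ →
               config (at q) h (homeTape ds ∷ []) [] ⇓ o

    open At

    Leads : ℕ → Maybe Lab → ℕ → Vec ℕ R → Bool → Set
    Leads L nothing  h ρ o = o ≡ false
    Leads L (just q) h ρ o = At L q h ρ o

    sweep-rule : ∀ {q op y n h ds out o} → prog q ≡ sweep op y n →
      let (c , es) = run op (carryIn op) ds in
      config (bwd (just q) c) h (homeTape es ∷ []) (emitted op es out) ⇓ o →
      config (at q) h (homeTape ds ∷ []) out ⇓ o
    sweep-rule {q} {op} {h = h} {ds} {out} {o} is k =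
      one (cong (λ i → map (NTM.perform machine w (config (at q) h (homeTape ds ∷ []) out)) (execute i q (scan w h) home)) is)
        (subst (λ τ → config (fwd (just q) (carryIn op)) h (τ ∷ []) out ⇓ o)
          (sym (moveTape-right [] home (cells ds)))
          (sweep-back (just q) (carryIn op) ds k′))
      where
      es = proj₂ (run op (carryIn op) ds)
      k′ : let (c , es) = sweepResult (just q) (carryIn op) ds in
           config (bwd (just q) c) h (homeTape es ∷ []) (emitted (operation (just q)) es out) ⇓ o
      k′ rewrite is | ++-identityʳ es = k

    leave-nothing : ∀ {q op y n c h ds o} → prog q ≡ sweep op y n →
      (if c then y else n) ≡ nothing → o ≡ false →
      config (bwd (just q) c) h (homeTape ds ∷ []) [] ⇓ o
    leave-nothing {q} {c = c} {h} {ds} is e refl =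
      reject (cong (λ m → map (NTM.perform machine w (config (bwd (just q) c) h (homeTape ds ∷ []) [])) (leave (Maybe.map at m)))
        (trans (cong (λ i → target i c) is) e)) refl

    leave-just : ∀ {q op y n c h ds out q′ o} → prog q ≡ sweep op y n →
      (if c then y else n) ≡ just q′ → config (at q′) h (homeTape ds ∷ []) out ⇓ o →
      config (bwd (just q) c) h (homeTape ds ∷ []) out ⇓ o
    leave-just {q} {c = c} {h} {ds} {out} is e k =
      one (cong (λ m → map (NTM.perform machine w (config (bwd (just q) c) h (homeTape ds ∷ []) out)) (leave (Maybe.map at m)))
        (trans (cong (λ i → target i c) is) e)) k

    leave-rule : ∀ {q op y n c h ds L ρ o} m → prog q ≡ sweep op y n →
      (if c then y else n) ≡ m → length ds ≡ L → Represents ds ρ → Leads L m h ρ o →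
      config (bwd (just q) c) h (homeTape ds ∷ []) [] ⇓ o
    leave-rule {c = c} nothing  is e len rep k = leave-nothing {c = c} is e k
    leave-rule {c = c} (just _) is e len rep k = leave-just {c = c} is e (elim k _ len rep)

    silent : Op R → Set
    silent op = ∀ d → emission op d ≡ nothing

    emitted-silent : ∀ {op} → silent op → ∀ ds out → emitted op ds out ≡ out
    emitted-silent s []       out = refl
    emitted-silent s (d ∷ ds) out rewrite s d = emitted-silent s ds out

    silent-sweep : ∀ {q op y n h ds o} → prog q ≡ sweep op y n → silent op →
      let (c , es) = run op (carryIn op) ds in
      config (bwd (just q) c) h (homeTape es ∷ []) [] ⇓ o →
      config (at q) h (homeTape ds ∷ []) [] ⇓ o
    silent-sweep {q} {op} {h = h} {ds} {o} is s k =
      sweep-rule is (subst (λ out → config (bwd (just q) _) h (homeTape es ∷ []) out ⇓ o)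
        (sym (emitted-silent s es [])) k)
      where es = proj₂ (run op (carryIn op) ds)

    -- An overflow rejects, which is just what `o ≡ false` asks for. Size estimates are thus owed on
    -- the accepting path only, and the continuation may always assume that the new value fits.
    inc-rule : ∀ {L q i q′ h ρ o} → prog q ≡ sweep (inc i) nothing (just q′) →
      (T o → suc (lookup ρ i) < 2 ^ L) →
      (suc (lookup ρ i) < 2 ^ L → At L q′ h (ρ [ i ]%= suc) o) → At L q h ρ o
    inc-rule {L} {q} {i} {q′} {h} {ρ} {o} is bound k .elim ds refl rep =
      silent-sweep is (λ _ → refl) (by-carry _ refl)
      where
      c  = proj₁ (run (inc i) true ds)
      es = proj₂ (run (inc i) true ds)

      dead : c ≡ true → ∀ o → (T o → suc (lookup ρ i) < 2 ^ length ds) → o ≡ false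
      dead e false _ = refl
      dead e true  b = ⊥-elim (<⇒≱ (b tt) (inc-overflow {ds = ds} {ρ} rep e))

      by-carry : ∀ c′ → c ≡ c′ → config (bwd (just q) c) h (homeTape es ∷ []) [] ⇓ o
      by-carry true  e = leave-nothing {c = c} is (cong (if_then nothing else just q′) e) (dead e o bound)
      by-carry false e = leave-rule {c = c} (just q′) is (cong (if_then nothing else just q′) e)
        (length-run (inc i) true ds) rep′
        (k (subst₂ _<_ (trans (rep′ i) (lookup∘updateAt i ρ)) (cong (2 ^_) (length-run (inc i) true ds)) (value< i es)))
        where rep′ = inc-represents {ds = ds} {ρ} rep e

    copy-rule : ∀ {L q ps y q′ h ρ o} → prog q ≡ sweep (copy ps) y (just q′) →
      At L q′ h (copyAll ps ρ) o → At L q h ρ o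
    copy-rule {q = q} {ps} {h = h} {ρ} {o} is k .elim ds refl rep =
      silent-sweep is (λ _ → refl)
        (subst (λ (c , es) → config (bwd (just q) c) h (homeTape es ∷ []) [] ⇓ o) (sym (run-copy ps false ds))
          (leave-rule {c = false} (just _) is refl (length-map (copyAll ps) ds) (copyAll-represents ps {ds} {ρ} rep) k))

    eq-rule : ∀ {L q i j y n h ρ o} → prog q ≡ sweep (eq i j) y n →
      (lookup ρ i ≡ lookup ρ j → Leads L y h ρ o) →
      (lookup ρ i ≢ lookup ρ j → Leads L n h ρ o) → At L q h ρ o
    eq-rule {q = q} {i} {j} {y} {n} {h} {ρ} {o} is same differ .elim ds refl rep =
      silent-sweep is (λ _ → refl)
        (subst (λ es → config (bwd (just q) c) h (homeTape es ∷ []) [] ⇓ o) (sym (run-eq i j true ds)) (by-carry _ refl))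
      where
      c = proj₁ (run (eq i j) true ds)
      by-carry : ∀ c′ → c ≡ c′ → config (bwd (just q) c) h (homeTape ds ∷ []) [] ⇓ o
      by-carry true e = leave-rule {c = c} y is (cong (if_then y else n) e) refl rep
        (same (trans (sym (rep i)) (trans (eq-true i j ds e) (rep j))))
      by-carry false e = leave-rule {c = c} n is (cong (if_then y else n) e) refl rep
        (differ (λ v → eq-false i j ds e (trans (rep i) (trans v (sym (rep j))))))

    le-rule : ∀ {L q i j y n h ρ o} → prog q ≡ sweep (le i j) y n →
      (lookup ρ i ≤ lookup ρ j → Leads L y h ρ o) →
      (lookup ρ j < lookup ρ i → Leads L n h ρ o) → At L q h ρ o
    le-rule {q = q} {i} {j} {y} {n} {h} {ρ} {o} is below above .elim ds refl rep =
      silent-sweep is (λ _ → refl)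
        (subst (λ es → config (bwd (just q) c) h (homeTape es ∷ []) [] ⇓ o) (sym (run-le i j true ds)) (by-carry _ refl))
      where
      c = proj₁ (run (le i j) true ds)
      by-carry : ∀ c′ → c ≡ c′ → config (bwd (just q) c) h (homeTape ds ∷ []) [] ⇓ o
      by-carry true e = leave-rule {c = c} y is (cong (if_then y else n) e) refl rep
        (below (subst₂ _≤_ (rep i) (rep j) (s≤s⁻¹ (le-true i j true ds e))))
      by-carry false e = leave-rule {c = c} n is (cong (if_then y else n) e) refl rep
        (above (subst₂ _≤_ (cong suc (rep j)) (rep i) (le-false i j true ds e)))

    -- The least significant digit is emitted last and so heads the stored output, which is the
    -- order that `fromDigits` expects.
    print-rule : ∀ {L q i y q′ h ρ} → prog q ≡ sweep (print i) y (just q′) → prog q′ ≡ halt →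
      (∀ out → fromDigits out ≡ lookup ρ i → P out) → At L q h ρ true
    print-rule {q = q} {i} {q′ = q′} {h} {ρ} is stop good .elim ds refl rep = sweep-rule is
      (subst (λ (c , es) → config (bwd (just q) c) h (homeTape es ∷ []) (emitted (print i) es []) ⇓ true) (sym (run-print i false ds))
        (leave-just {c = false} is refl
          (accept (cong (λ instr → map (NTM.perform machine w (config (at q′) h (homeTape ds ∷ []) (emitted (print i) ds []))) (execute instr q′ (scan w h) home)) stop)
            (subst (λ i → T (halts i)) (sym stop) tt) (good _ (trans (printed ds) (rep i))))))
      where
      printed : ∀ ds → fromDigits (emitted (print i) ds []) ≡ value i ds
      printed [] = refl
      printed (d ∷ ds) rewrite printed ds | *-comm (value i ds) 2 with lookup d i
      ... | false = refl
      ... | true  = refl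

    private
      branch-≡ : ∀ {q f h ms out τ} → prog q ≡ branch f → f (scan w h) ≡ ms →
        successors w (config (at q) h (homeTape τ ∷ []) out) ≡
        map (λ (m , q′) → config (at q′) (moveInput w m h) (homeTape τ ∷ []) out) ms
      branch-≡ {h = h} is refl rewrite is = sym (map-∘ _)

    move-rule : ∀ {L q f h m q′ ρ o} → prog q ≡ branch f → f (scan w h) ≡ (m , q′) ∷ [] →
      At L q′ (moveInput w m h) ρ o → At L q h ρ o
    move-rule is e k .elim ds len rep = one (branch-≡ is e) (elim k ds len rep)

    stuck-rule : ∀ {L q f h ρ o} → prog q ≡ branch f → f (scan w h) ≡ [] → o ≡ false → At L q h ρ o
    stuck-rule is e refl .elim ds len rep = reject (branch-≡ is e) (cong halts is)

    module _ {L : ℕ} {q : Lab} {f : Scanned A → List (Move × Lab)} {h : ℕ} {m₁ m₂ : Move} {q₁ q₂ : Lab}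
             {ρ : Vec ℕ R} (is : prog q ≡ branch f) (e : f (scan w h) ≡ (m₁ , q₁) ∷ (m₂ , q₂) ∷ []) where

      fork-false-rule : At L q₁ (moveInput w m₁ h) ρ false → At L q₂ (moveInput w m₂ h) ρ false → At L q h ρ false
      fork-false-rule k₁ k₂ .elim ds len rep = fork-false (branch-≡ is e) (elim k₁ ds len rep) (elim k₂ ds len rep)

      fork-left-rule : At L q₁ (moveInput w m₁ h) ρ true → At L q₂ (moveInput w m₂ h) ρ false → At L q h ρ true
      fork-left-rule k₁ k₂ .elim ds len rep = fork-left (branch-≡ is e) (elim k₁ ds len rep) (elim k₂ ds len rep)

      fork-right-rule : At L q₁ (moveInput w m₁ h) ρ false → At L q₂ (moveInput w m₂ h) ρ true → At L q h ρ true
      fork-right-rule k₁ k₂ .elim ds len rep = fork-right (branch-≡ is e) (elim k₁ ds len rep) (elim k₂ ds len rep)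

  -- Counting the length of the input.

  module Start (w : List A) (P : List Bit → Set) where
    open Outcome machine w P
    open Rules w P
    open At

    clockOnly : ℕ → Vec ℕ R
    clockOnly i = replicate R 0 [ clock ]≔ i

    -- The new cell has weight `2 ^ length ds` and its clock digit is the carry, so it absorbs
    -- exactly the carry term of `inc-value`.
    grown-represents : ∀ {i ds} → Represents ds (clockOnly i) →
      let (c , es) = run (inc clock) true ds in
      Represents (es ++ grown nothing c) (clockOnly (suc i))
    grown-represents {i} {ds} rep j with j Fin.≟ clock
    ... | yes refl = begin
      value clock (es ++ grown nothing c)                         ≡⟨ value-++ clock es _ ⟩
      value clock es + 2 ^ length es * value clock (grown nothing c) ≡⟨ cong₂ (λ l g → value clock es + 2 ^ l * g) (length-run (inc clock) true ds) (value-grown c) ⟩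
      value clock es + 2 ^ length ds * digit c                      ≡⟨ inc-value clock true ds ⟩
      suc (value clock ds)                                        ≡⟨ cong suc (rep clock) ⟩
      suc (lookup (clockOnly i) clock)                            ≡⟨ cong suc (lookup∘update clock (replicate R 0) i) ⟩
      suc i                                                       ≡⟨ sym (lookup∘update clock (replicate R 0) (suc i)) ⟩
      lookup (clockOnly (suc i)) clock ∎
      where
      open ≡-Reasoning
      c  = proj₁ (run (inc clock) true ds)
      es = proj₂ (run (inc clock) true ds)
      value-grown : ∀ c → value clock (grown nothing c) ≡ digit c
      value-grown true  = value-clockDigit
      value-grown false = refl
    ... | no j≢clock = begin
      value j (es ++ grown nothing c)                     ≡⟨ value-++ j es _ ⟩
      value j es + 2 ^ length es * value j (grown nothing c) ≡⟨ cong₂ (λ v g → v + 2 ^ length es * g) (inc-value-other true ds j≢clock) (value-grown c) ⟩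
      value j ds + 2 ^ length es * 0                      ≡⟨ cong (value j ds +_) (*-zeroʳ (2 ^ length es)) ⟩
      value j ds + 0                                      ≡⟨ +-identityʳ _ ⟩
      value j ds                                          ≡⟨ rep j ⟩
      lookup (clockOnly i) j                              ≡⟨ lookup∘update′ j≢clock (replicate R 0) i ⟩
      lookup (replicate R 0) j                            ≡⟨ sym (lookup∘update′ j≢clock (replicate R 0) (suc i)) ⟩
      lookup (clockOnly (suc i)) j ∎
      where
      open ≡-Reasoning
      c  = proj₁ (run (inc clock) true ds)
      es = proj₂ (run (inc clock) true ds)
      value-grown : ∀ c → value j (grown nothing c) ≡ 0
      value-grown false = refl
      value-grown true  = cong (λ b → digit b + 0)
        (trans (lookup∘update′ j≢clock (replicate R false) true) (lookup-replicate j false))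

    -- The width is whatever the count has produced. The continuation learns that it holds
    -- `suc (length w)`, because the clock stores that number.
    count-rule : ∀ {o} d i ds → d + i ≡ suc (length w) → Represents ds (clockOnly i) →
      (∀ L → suc (length w) < 2 ^ L → At L first (suc (length w)) (clockOnly (suc (length w))) o) →
      config count i (homeTape ds ∷ []) [] ⇓ o
    count-rule {o} zero i ds refl rep k =
      one (cong (λ a → NTM.perform machine w (config count i (homeTape ds ∷ []) []) (onInput a home) ∷ []) (scan-⊣ w))
        (elim (k (length ds) (≤-trans (s≤s (≤-reflexive (sym (trans (rep clock) (lookup∘update clock (replicate R 0) _))))) (value< clock ds))) ds refl rep)
    count-rule {o} (suc d) i ds e rep k =
      one (cong (λ a → NTM.perform machine w (config count i (homeTape ds ∷ []) []) a ∷ [])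
            (onInput-inside w i home i<n))
        (subst₂ (λ h τ → config (fwd nothing true) h (τ ∷ []) [] ⇓ o)
          (sym (m≤n⇒m⊓n≡m i<n)) (sym (moveTape-right [] home (cells ds)))
          (sweep-back nothing true ds
            (one refl (subst (λ out → config count (suc i) (homeTape es ∷ []) out ⇓ o) (sym (emitted-silent {inc clock} (λ _ → refl) es []))
              (count-rule d (suc i) es (trans (+-suc d i) e) (grown-represents {i} {ds} rep) k)))))
      where
      es = let (c , es) = run (inc clock) true ds in es ++ grown nothing c
      i<n : i < suc (length w)
      i<n = ≤-trans (s≤s (m≤n+m i d)) (≤-reflexive e)

    start-rule : ∀ {o} →
      (∀ L → suc (length w) < 2 ^ L → At L first (suc (length w)) (clockOnly (suc (length w))) o) →
      initial ⇓ o
    start-rule k = one refl (one refl (one refl (count-rule (suc (length w)) 0 [] (+-identityʳ _) empty k)))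
      where
      empty : Represents [] (clockOnly 0)
      empty j with j Fin.≟ clock
      ... | yes refl = sym (lookup∘update clock (replicate R 0) 0)
      ... | no j≢clock = sym (trans (lookup∘update′ j≢clock (replicate R 0) 0) (lookup-replicate j 0))

  -- The space bound, on arbitrary inputs.

  module Space (w : List A) where
    -- The clock value of the whole tape when the head has the digits ps
    -- on its left, nearest first, and the rest contributes V.
    plug : List (Vec Bool R) → ℕ → ℕ
    plug []       V = V
    plug (p ∷ ps) V = plug ps (digit (lookup p clock) + 2 * V)

    2^length≤plug : ∀ ps V → 2 ^ length ps * V ≤ plug ps V
    2^length≤plug []       V = ≤-reflexive (+-identityʳ V)
    2^length≤plug (p ∷ ps) V = begin
      2 * 2 ^ length ps * V       ≡⟨ cong (_* V) (*-comm 2 (2 ^ length ps)) ⟩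
      2 ^ length ps * 2 * V       ≡⟨ *-assoc (2 ^ length ps) 2 V ⟩
      2 ^ length ps * (2 * V)     ≤⟨ *-monoʳ-≤ (2 ^ length ps) (m≤n+m (2 * V) (digit (lookup p clock))) ⟩
      2 ^ length ps * (digit (lookup p clock) + 2 * V) ≤⟨ 2^length≤plug ps _ ⟩
      plug ps (digit (lookup p clock) + 2 * V) ∎
      where open ≤-Reasoning

    limit : ℕ
    limit = 3 + 2 * length w

    -- During the count the clock is at most h, and only a carry out of the
    -- last digit makes the tape longer; later its length L is constant.
    Zone : Maybe Lab → ℕ → ℕ → ℕ → Set
    Zone nothing  h V L = h ≤ suc (length w) × V ≤ h × 2 ^ L ≤ suc (2 * h)
    Zone (just _) h V L = 2 ^ L ≤ limit

    zone-limit : ∀ t {h V L} → Zone t h V L → 2 ^ L ≤ limit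
    zone-limit nothing (h≤ , _ , L≤) = ≤-trans L≤ (≤-trans (s≤s (*-monoʳ-≤ 2 h≤)) (≤-reflexive (cong suc (*-suc 2 (length w)))))
    zone-limit (just _) L≤ = L≤

    zone-map : ∀ t {h V V′ L L′} → (t ≡ nothing → V′ ≡ V) → L′ ≡ L → Zone t h V L → Zone t h V′ L′
    zone-map nothing v refl (h≤ , V≤ , L≤) = h≤ , ≤-trans (≤-reflexive (v refl)) V≤ , L≤
    zone-map (just _) _ refl z = z

    around : List (Vec Bool R) → List (Vec Bool R) → Tape (Cell R)
    around ps ds = focus (map dig ps ++ home ∷ []) (cells ds)

    -- An invariant of all reachable configurations. During a forward sweep the pending carry is
    -- added at the position of the head, so a sweep of the count leaves the clock value unchanged
    -- once it has begun.
    data Fits : Config → Set where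
      boot  : Fits initial
      count : ∀ {h ds out} → Zone nothing h (value clock ds) (length ds) →
              Fits (config count h (homeTape ds ∷ []) out)
      at    : ∀ {q h ds out} → 2 ^ length ds ≤ limit → Fits (config (at q) h (homeTape ds ∷ []) out)
      fwd   : ∀ {t b h out} ps ds → Zone t h (plug ps (digit b + value clock ds)) (length ps + length ds) →
              Fits (config (fwd t b) h (around ps ds ∷ []) out)
      bwd   : ∀ {t b h out} ps ds → Zone t h (plug ps (value clock ds)) (length ps + length ds) →
              Fits (config (bwd t b) h (around ps ds ∷ []) out)
      back  : ∀ {t b h ds out} → Zone t h (value clock ds) (length ds) →
              Fits (config (bwd t b) h (homeTape ds ∷ []) out)

    fits-step : ∀ {c c′} → Fits c → c′ ∈ successors w c → Fits c′
    fits-step boot (here refl) = bwd [] [] (z≤n , z≤n , ≤-refl)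
    fits-step (count {h} {ds} {out} z@(h≤ , V≤ , L≤)) m with m≤n⇒m<n∨m≡n h≤
    fits-step (count {h} {ds} {out} z@(h≤ , V≤ , L≤)) m | inj₁ h<
      with here refl ← subst (λ a → _ ∈ NTM.perform machine w (config count h (homeTape ds ∷ []) out) a ∷ []) (onInput-inside w h home h<) m =
      subst₂ (λ h τ → Fits (config (fwd nothing true) h (τ ∷ []) out))
        (sym (m≤n⇒m⊓n≡m h<)) (sym (moveTape-right [] home (cells ds)))
        (fwd [] ds (h< , s≤s V≤ , ≤-trans L≤ (s≤s (*-monoʳ-≤ 2 (n≤1+n h)))))
    fits-step (count {h} {ds} {out} z) m | inj₂ refl
      with here refl ← subst (λ a → _ ∈ NTM.perform machine w (config count h (homeTape ds ∷ []) out) (onInput a home) ∷ []) (scan-⊣ w) m =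
      at (zone-limit nothing {V = value clock ds} {length ds} z)
    fits-step (at {q} {h} {ds} bound) m with prog q
    fits-step (at {q} {h} {ds} bound) m | branch f with ∈-map⁻ _ m
    ... | _ , m′ , refl with ∈-map⁻ _ m′
    ... | _ , _ , refl = at bound
    fits-step (at {q} {h} {ds} {out} bound) (here refl) | sweep op _ _ =
      subst (λ τ → Fits (config (fwd (just q) (carryIn op)) h (τ ∷ []) out)) (sym (moveTape-right [] home (cells ds)))
        (fwd [] ds bound)
    fits-step (fwd {nothing} {true} {h} ps [] (h≤ , V≤ , L≤)) (here refl) =
      -- A digit is added only when the clock has reached `2 ^ length ps`. The clock is at most `h`,
      -- so the doubled power is at most `2 * h`.
      bwd (clockDigit ∷ ps) [] (h≤ , ≤-trans (≤-reflexive (cong (plug ps) value-clockDigit)) V≤ , (begin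
        2 * 2 ^ (length ps + 0)  ≡⟨ cong (λ l → 2 * 2 ^ l) (+-identityʳ (length ps)) ⟩
        2 * 2 ^ length ps        ≡⟨ cong (2 *_) (sym (*-identityʳ (2 ^ length ps))) ⟩
        2 * (2 ^ length ps * 1)  ≤⟨ *-monoʳ-≤ 2 (≤-trans (2^length≤plug ps 1) V≤) ⟩
        2 * h                    ≤⟨ n≤1+n _ ⟩
        suc (2 * h)              ∎))
      where open ≤-Reasoning
    fits-step (fwd {nothing} {false} ps [] z) (here refl) = bwd ps [] z
    fits-step (fwd {just _} ps [] z) (here refl) = bwd ps [] z
    fits-step (fwd {t} {b} {h} {out} ps (d ∷ ds) z) (here refl) =
      subst (λ τ → Fits (config (fwd t b′) h (τ ∷ []) out)) (sym (moveTape-right _ (dig d′) (cells ds)))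
        (fwd (d′ ∷ ps) ds (zone-map t carry (sym (+-suc (length ps) (length ds))) z))
      where
      b′ = proj₁ (step (operation t) b d)
      d′ = proj₂ (step (operation t) b d)
      carry : t ≡ nothing → plug (d′ ∷ ps) (digit b′ + value clock ds) ≡ plug ps (digit b + value clock (d ∷ ds))
      carry refl = cong (plug ps) (trans
        (cong (λ c → digit c + 2 * (digit (b ∧ lookup d clock) + value clock ds)) (lookup∘updateAt clock {b xor_} d))
        (full-adder b (lookup d clock) (value clock ds)))
    fits-step (bwd [] [] z) (here refl) = back {ds = []} z
    fits-step (bwd [] (d ∷ ds) z) (here refl) = back z
    fits-step (bwd {t} (p ∷ ps) [] z) (here refl) = bwd ps (p ∷ []) (zone-map t (λ _ → refl) (+-suc (length ps) 0) z)
    fits-step (bwd {t} (p ∷ ps) (d ∷ ds) z) (here refl) = bwd ps (p ∷ d ∷ ds) (zone-map t (λ _ → refl) (+-suc (length ps) _) z)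
    fits-step (back {nothing} {ds = ds} z) (here refl) = count {ds = ds} z
    fits-step (back {just q} {b} z) m with target (prog q) b
    fits-step (back {just q} {b} z) (here refl) | just q′ = at z

    fits-star : ∀ {c c′} → Fits c → Star (_⟶_ w) c c′ → Fits c′
    fits-star f ε       = f
    fits-star f (m ◅ p) = fits-star (fits-step f m) p

    length-cells : ∀ ds → length (cells ds) ≡ suc (length ds)
    length-cells ds = trans (length-++ (map dig ds)) (trans (+-comm _ 1) (cong suc (length-map dig ds)))

    visited-around : ∀ ps ds → visited (around ps ds) + 0 ≡ 2 + (length ps + length ds)
    visited-around ps ds = begin
      visited (around ps ds) + 0                 ≡⟨ +-identityʳ _ ⟩
      visited (around ps ds)                     ≡⟨ visited-focus ds ⟩
      length (map dig ps ++ home ∷ []) + length (cells ds) ≡⟨ cong₂ _+_ (trans (length-++ (map dig ps)) (cong (_+ 1) (length-map dig ps))) (length-cells ds) ⟩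
      length ps + 1 + suc (length ds)            ≡⟨ +-suc (length ps + 1) (length ds) ⟩
      suc (length ps + 1 + length ds)            ≡⟨ cong (λ l → suc (l + length ds)) (+-comm (length ps) 1) ⟩
      2 + (length ps + length ds)                ∎
      where
      open ≡-Reasoning
      visited-focus : ∀ ds → visited (focus (map dig ps ++ home ∷ []) (cells ds)) ≡ length (map dig ps ++ home ∷ []) + length (cells ds)
      visited-focus []      = refl
      visited-focus (_ ∷ _) = refl

    visited-home : ∀ ds → visited (homeTape ds) + 0 ≡ 2 + length ds
    visited-home ds = trans (+-identityʳ _) (cong suc (length-cells ds))

    fits-space : ∀ {c} → Fits c → ∃[ L ] space c ≤ 2 + L × 2 ^ L ≤ limit
    fits-space boot = 0 , s≤s z≤n , s≤s z≤n
    fits-space (count {ds = ds} z) = _ , ≤-reflexive (visited-home ds) , zone-limit nothing {V = value clock ds} {length ds} z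
    fits-space (at {ds = ds} z) = _ , ≤-reflexive (visited-home ds) , z
    fits-space (fwd {t} ps ds z) = _ , ≤-reflexive (visited-around ps ds) , zone-limit t z
    fits-space (bwd {t} ps ds z) = _ , ≤-reflexive (visited-around ps ds) , zone-limit t z
    fits-space (back {t} {ds = ds} z) = _ , ≤-reflexive (visited-home ds) , zone-limit t z

  logSpace : LogSpace
  -- The cells `home` and `blank` around the digits contribute 2, and `log-width` contributes 3.
  logSpace = 5 , λ w c p →
    let open Space w
        L , c≤ , L≤ = fits-space (fits-star boot p)
    in begin
      space c                        ≤⟨ c≤ ⟩
      2 + L                          ≤⟨ +-monoʳ-≤ 2 (log-width L (length w) L≤) ⟩
      5 + ⌊log₂ length w ⌋           ≤⟨ +-monoʳ-≤ 5 (m≤n*m _ 5) ⟩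
      5 + 5 * ⌊log₂ length w ⌋       ≡⟨ sym (*-suc 5 _) ⟩
      5 * suc ⌊log₂ length w ⌋       ∎
    where open ≤-Reasoning

-- Levels in max-unique graphs

-- Partial sums, because the loops visit the vertices in index order and their invariants speak of
-- those already passed.
prefix : ∀ {n} → ℕ → (Fin n → ℕ) → ℕ
prefix         zero    f = 0
prefix {zero}  (suc m) f = 0
prefix {suc n} (suc m) f = f zero + prefix m (f ∘ suc)

total : ∀ {n} → (Fin n → ℕ) → ℕ
total {n} = prefix n

prefix-suc : ∀ {n} (f : Fin n → ℕ) u → prefix (suc (toℕ u)) f ≡ prefix (toℕ u) f + f u
prefix-suc f zero    = +-identityʳ (f zero)
prefix-suc f (suc u) = trans (cong (f zero +_) (prefix-suc (f ∘ suc) u)) (sym (+-assoc (f zero) _ _))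

prefix-mono : ∀ {n} m {f g : Fin n → ℕ} → (∀ u → f u ≤ g u) → prefix m f ≤ prefix m g
prefix-mono         zero    h = z≤n
prefix-mono {zero}  (suc m) h = z≤n
prefix-mono {suc n} (suc m) h = +-mono-≤ (h zero) (prefix-mono m (h ∘ suc))

prefix-cong : ∀ {n} m {f g : Fin n → ℕ} → (∀ u → f u ≡ g u) → prefix m f ≡ prefix m g
prefix-cong m h = ≤-antisym (prefix-mono m (≤-reflexive ∘ h)) (prefix-mono m (≤-reflexive ∘ sym ∘ h))

prefix-+ : ∀ {n} m (f g : Fin n → ℕ) → prefix m (λ u → f u + g u) ≡ prefix m f + prefix m g
prefix-+         zero    f g = refl
prefix-+ {zero}  (suc m) f g = refl
prefix-+ {suc n} (suc m) f g rewrite prefix-+ m (f ∘ suc) (g ∘ suc) =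
  solve 4 (λ a b c d → (a :+ b) :+ (c :+ d) := (a :+ c) :+ (b :+ d)) refl (f zero) (g zero) _ _

prefix≤total : ∀ {n} m (f : Fin n → ℕ) → prefix m f ≤ total f
prefix≤total         zero    f = z≤n
prefix≤total {zero}  (suc m) f = z≤n
prefix≤total {suc n} (suc m) f = +-monoʳ-≤ (f zero) (prefix≤total m (f ∘ suc))

term≤total : ∀ {n} (f : Fin n → ℕ) u → f u ≤ total f
term≤total f zero    = m≤m+n _ _
term≤total f (suc u) = ≤-trans (term≤total (f ∘ suc) u) (m≤n+m _ _)

prefix≤ : ∀ {n} m {f : Fin n → ℕ} → (∀ u → f u ≤ 1) → prefix m f ≤ m
prefix≤         zero    h = z≤n
prefix≤ {zero}  (suc m) h = z≤n
prefix≤ {suc n} (suc m) h = +-mono-≤ (h zero) (prefix≤ m (h ∘ suc))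

total-const : ∀ n c → total {n} (λ _ → c) ≡ n * c
total-const zero    c = refl
total-const (suc n) c = cong (c +_) (total-const n c)

total-bound : ∀ {n c} {f : Fin n → ℕ} → (∀ u → f u ≤ c) → total f ≤ n * c
total-bound {n} {c} h = ≤-trans (prefix-mono n h) (≤-reflexive (total-const n c))

total-witness : ∀ {n} (f : Fin n → ℕ) → total f ≢ 0 → ∃[ u ] f u ≢ 0
total-witness {zero}  f ≢0 = contradiction refl ≢0
total-witness {suc n} f ≢0 with f zero in e
... | suc _ = zero , λ e′ → 1+n≢0 (trans (sym e) e′)
... | zero  = let (u , h) = total-witness (f ∘ suc) ≢0 in suc u , h

digit-T : ∀ {b} → T b → digit b ≡ 1
digit-T {true} _ = refl

T-digit : ∀ {b} → digit b ≢ 0 → T b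
T-digit {true}  _ = _
T-digit {false} h = contradiction refl h

¬T⇒≡ : ∀ {b} → ¬ T b → b ≡ false
¬T⇒≡ {true}  h = contradiction _ h
¬T⇒≡ {false} _ = refl

digit-¬T : ∀ {b} → ¬ T b → digit b ≡ 0
digit-¬T h = cong digit (¬T⇒≡ h)

digit-mono : ∀ {b c} → (T b → T c) → digit b ≤ digit c
digit-mono {false}        h = z≤n
digit-mono {true} {true}  h = ≤-refl
digit-mono {true} {false} h = contradiction _ h

filterᵇ-none : ∀ {A : Set} (p : A → Bool) xs → (∀ x → ¬ T (p x)) → List.length (filterᵇ p xs) ≡ 0
filterᵇ-none p []       h = refl
filterᵇ-none p (x ∷ xs) h with p x in e
... | false = filterᵇ-none p xs h
... | true  = contradiction (subst T (sym e) _) (h x)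

-- Paths in acyclic graphs.

module Paths {n : ℕ} (G : Digraph n) where

  length-◅◅ : ∀ {u v w} (p : Path G u v) (q : Path G v w) → pathLength G (p ◅◅ q) ≡ pathLength G p + pathLength G q
  length-◅◅ ε       q = refl
  length-◅◅ (e ◅ p) q = cong suc (length-◅◅ p q)

  unsnoc : ∀ {u v} (p : Path G u v) → pathLength G p ≢ 0 →
           ∃[ x ] Σ[ q ∈ Path G u x ] Edge G x v × pathLength G p ≡ suc (pathLength G q)
  unsnoc ε           h = contradiction refl h
  unsnoc (e ◅ ε)     h = _ , ε , e , refl
  unsnoc (e ◅ f ◅ p) h = let (x , q , e′ , l) = unsnoc (f ◅ p) 1+n≢0 in x , e ◅ q , e′ , cong suc l

  vertexAt : ∀ {u v} (p : Path G u v) → Fin (suc (pathLength G p)) → Fin n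
  vertexAt {u} p       zero    = u
  vertexAt     (e ◅ p) (suc i) = vertexAt p i

  vertexAt-mono : ∀ {u v} (p : Path G u v) {i j} → i Fin.< j → TransClosure (Edge G) (vertexAt p i) (vertexAt p j)
  vertexAt-mono (e ◅ p) {zero}  {suc zero}    _ = [ e ]
  vertexAt-mono (e ◅ p) {zero}  {suc (suc j)} _ = e ∷ vertexAt-mono p {zero} {suc j} (s≤s z≤n)
  vertexAt-mono (e ◅ p) {suc i} {suc j} i<j = vertexAt-mono p (s≤s⁻¹ i<j)

  module _ (acyclic : Acyclic G) where

    -- A path with `n` or more edges visits more than `n` positions; by the pigeonhole principle a
    -- vertex recurs, which closes a cycle.
    pathLength< : ∀ {u v} (p : Path G u v) → pathLength G p < n
    pathLength< p with pathLength G p <? n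
    ... | yes l<n = l<n
    ... | no  l≮n with pigeonhole (s≤s (≮⇒≥ l≮n)) (vertexAt p)
    ... | i , j , i<j , same = contradiction
      (subst (TransClosure (Edge G) (vertexAt p i)) (sym same) (vertexAt-mono p i<j)) (acyclic _)

    private
      isSPO : IsStrictPartialOrder _≡_ (TransClosure (Edge G))
      isSPO = record
        { isEquivalence = isEquivalence
        ; irrefl = λ { refl → acyclic _ }
        ; trans = Plus._++_
        ; <-resp-≈ = (λ { refl h → h }) , (λ { refl h → h }) }

    -- In an acyclic graph the transitive closure of the edges is a strict partial order, and on a
    -- finite set such an order is well-founded in both directions.
    edge-wellFounded : WellFounded (Edge G)
    edge-wellFounded = Plus.wellFounded⁻ _ (spo-wellFounded isSPO)

    edge-noetherian : WellFounded (flip (Edge G))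
    edge-noetherian v = go (spo-noetherian isSPO v)
      where
      go : ∀ {v} → Acc (flip (TransClosure (Edge G))) v → Acc (flip (Edge G)) v
      go (acc r) = acc λ e → go (r [ e ])

    loop-ε : ∀ {v} (p : Path G v v) → p ≡ ε
    loop-ε ε       = refl
    loop-ε (e ◅ p) = contradiction (close e p) (acyclic _)
      where
      close : ∀ {u v w} → Edge G u v → Path G v w → TransClosure (Edge G) u w
      close e ε       = [ e ]
      close e (f ◅ p) = e ∷ close f p

    -- Going backwards along edges must end, and it can end only at a vertex without predecessors,
    -- which is `s`.
    from-source : ∀ {s} → IsUniqueSource G s → ∀ v → Path G s v
    from-source {s} (_ , unique) v = go v (edge-wellFounded v)
      where
      go : ∀ v → Acc (Edge G) v → Path G s v
      go v (acc r) with any? (λ u → T? (G u v))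
      ... | yes (u , e) = go u (r e) ◅◅ (e ◅ ε)
      ... | no none rewrite unique v (filterᵇ-none _ (allFin n) (λ u e → none (u , e))) = ε

    to-sink : ∀ {t} → IsUniqueSink G t → ∀ v → Path G v t
    to-sink {t} (_ , unique) v = go v (edge-noetherian v)
      where
      go : ∀ v → Acc (flip (Edge G)) v → Path G v t
      go v (acc r) with any? (λ u → T? (G v u))
      ... | yes (u , e) = e ◅ go u (r e)
      ... | no none rewrite unique v (filterᵇ-none _ (allFin n) (λ u e → none (u , e))) = ε

-- Levels and the sums that the machine computes from them.

module Levels {n : ℕ} (G : Digraph n) (s t : Fin n) (acyclic : Acyclic G)
  (source : IsUniqueSource G s) (sink : IsUniqueSink G t) (maxUnique : MaxUnique G) where

  open Paths G

  longest : ∀ v → Path G s v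
  longest v = proj₁ (maxUnique s v (from-source acyclic source v))

  level : Fin n → ℕ
  level v = pathLength G (longest v)

  longest-isLongest : ∀ v → IsLongest G (longest v)
  longest-isLongest v = proj₁ (proj₂ (maxUnique s v (from-source acyclic source v)))

  longest-unique : ∀ v (q : Path G s v) → level v ≤ pathLength G q → longest v ≡ q
  longest-unique v q h = proj₂ (proj₂ (maxUnique s v (from-source acyclic source v)))
    (λ r → ≤-trans (longest-isLongest v r) h)

  level<n : ∀ v → level v < n
  level<n v = pathLength< acyclic (longest v)

  level-edge : ∀ {u v} → Edge G u v → level u < level v
  level-edge {u} {v} e = ≤-trans
    (≤-reflexive (sym (trans (length-◅◅ (longest u) (e ◅ ε)) (+-comm _ 1))))
    (longest-isLongest v (longest u ◅◅ (e ◅ ε)))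

  level-predecessor : ∀ {k v} → k < level v → ∃[ u ] Edge G u v × k ≤ level u
  level-predecessor {k} {v} k<l with unsnoc (longest v) (λ e → n≮0 (subst (k <_) e k<l))
  ... | u , q , e , l = u , e , s≤s⁻¹ (≤-trans (subst (k <_) l k<l) (s≤s (longest-isLongest u q)))

  -- A longest path to `v` can be prolonged to `t`. This is why the last nonempty stage is the
  -- answer.
  level≤sink : ∀ v → level v ≤ level t
  level≤sink v = ≤-trans (≤-trans (m≤m+n _ _) (≤-reflexive (sym (length-◅◅ (longest v) q)))) (longest-isLongest t (longest v ◅◅ q))
    where q = to-sink acyclic sink v

  atLeast : ℕ → Fin n → ℕ
  atLeast k u = digit (k ≤ᵇ level u)

  predecessorAtLeast : ℕ → Fin n → Fin n → ℕ
  predecessorAtLeast k v u = digit ((k ≤ᵇ level u) ∧ G u v)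

  -- The closed form of `atLeast 1 u + ... + atLeast k u`: summed over all vertices it is the
  -- running total of the counts, which reaches the sum of the levels at the top.
  truncated : ℕ → Fin n → ℕ
  truncated k u = k ⊓ level u

  total-atLeast-0 : total (atLeast 0) ≡ n
  total-atLeast-0 = trans (total-const n 1) (*-identityʳ n)

  predecessors-zero : ∀ {k v} → total (predecessorAtLeast k v) ≡ 0 → atLeast (suc k) v ≡ 0
  predecessors-zero {k} {v} h = digit-¬T λ k<l →
    let (u , e , k≤l) = level-predecessor {k} {v} (≤ᵇ⇒≤ _ _ k<l)
    in contradiction (trans (sym (digit-T (Equivalence.from T-∧ (≤⇒≤ᵇ k≤l , e)))) (n≤0⇒n≡0 (≤-trans (term≤total (predecessorAtLeast k v) u) (≤-reflexive h)))) λ ()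

  predecessors-nonzero : ∀ {k v} → total (predecessorAtLeast k v) ≢ 0 → atLeast (suc k) v ≡ 1
  predecessors-nonzero {k} {v} h =
    let (u , d) = total-witness (predecessorAtLeast k v) h
        (k≤l , e) = Equivalence.to T-∧ (T-digit d)
    in digit-T (≤⇒≤ᵇ (≤-trans (s≤s (≤ᵇ⇒≤ k _ k≤l)) (level-edge e)))

  truncated-suc : ∀ k u → truncated (suc k) u ≡ truncated k u + atLeast (suc k) u
  truncated-suc k u = go k (level u)
    where
    go : ∀ k l → suc k ⊓ l ≡ k ⊓ l + digit (suc k ≤ᵇ l)
    go zero    zero    = refl
    go zero    (suc l) = refl
    go (suc k) zero    = refl
    go (suc k) (suc l) = cong suc (go k l)

  total-truncated-suc : ∀ k → total (truncated (suc k)) ≡ total (truncated k) + total (atLeast (suc k))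
  total-truncated-suc k = trans (prefix-cong n (truncated-suc k)) (prefix-+ n (truncated k) (atLeast (suc k)))

  total-truncated-0 : total (truncated 0) ≡ 0
  total-truncated-0 = trans (total-const n 0) (*-zeroʳ n)

  top-reached : ∀ {k} → total (atLeast (suc k)) ≡ 0 → ∀ u → level u ≤ k
  top-reached {k} h u = ≮⇒≥ λ k<l → contradiction
    (trans (sym (digit-T (≤⇒≤ᵇ k<l))) (n≤0⇒n≡0 (≤-trans (term≤total (atLeast (suc k)) u) (≤-reflexive h)))) λ ()

  top-not-reached : ∀ {k} → total (atLeast (suc k)) ≢ 0 → k < level t
  top-not-reached {k} h = let (u , d) = total-witness (atLeast (suc k)) h
    in ≤-trans (≤ᵇ⇒≤ _ _ (T-digit d)) (level≤sink u)

  total-truncated-top : ∀ {k} → total (atLeast (suc k)) ≡ 0 → total (truncated k) ≡ total level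
  total-truncated-top h = prefix-cong n (λ u → m≥n⇒m⊓n≡n (top-reached h u))

  total-truncated≤ : ∀ k → total (truncated k) ≤ total level
  total-truncated≤ k = prefix-mono n (λ u → m⊓n≤n k (level u))

  total-level≤ : total level ≤ n * n
  total-level≤ = total-bound (λ u → <⇒≤ (level<n u))

  atLeast≤1 : ∀ k u → atLeast k u ≤ 1
  atLeast≤1 k u = digit≤1 _

  predecessorAtLeast≤1 : ∀ k v u → predecessorAtLeast k v u ≤ 1
  predecessorAtLeast≤1 k v u = digit≤1 _

  level-sink : IsLongestPathLength G s t (level t)
  level-sink = longest t , longest-isLongest t , refl

-- The program

-- A sum of finite types, so that its bijection with `Fin` is assembled from combinators; the
-- pattern synonyms give the labels their names.
Lab : Set
Lab = (Bool × Fin 7) ⊎ Fin 9 ⊎ Fin 10 ⊎ Fin 8 ⊎ Fin 10 ⊎ Fin 3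

Lab-finite : Lab ↔ Fin (2 * 7 + (9 + (10 + (8 + (10 + 3)))))
Lab-finite = sum (↔-trans (↔-sym 2↔Bool ×-↔ ↔-id _) (↔-sym *↔×))
  (sum (↔-id _) (sum (↔-id _) (sum (↔-id _) (sum (↔-id _) (↔-id _)))))
  where
  sum : ∀ {A B : Set} {m n} → A ↔ Fin m → B ↔ Fin n → (A ⊎ B) ↔ Fin (m + n)
  sum f g = ↔-trans (f ⊎-↔ g) (↔-sym +↔⊎)

-- Moves the input head to the row of the vertex in curr; the Boolean
-- selects where to continue.
pattern rewind σ    = inj₁ (σ , 0F)
pattern skipSrc σ   = inj₁ (σ , 1F)
pattern skipSink σ  = inj₁ (σ , 2F)
pattern clearRow σ  = inj₁ (σ , 3F)
pattern testRow σ   = inj₁ (σ , 4F)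
pattern skipRow σ   = inj₁ (σ , 5F)
pattern countRow σ  = inj₁ (σ , 6F)

pattern setup i     = inj₂ (inj₁ i)
pattern begin₀      = setup 0F
pattern readSrc     = setup 1F
pattern incSrc      = setup 2F
pattern skipSink₀   = setup 3F
pattern readRow     = setup 4F
pattern incSize     = setup 5F
pattern guess       = setup 6F
pattern incGoal     = setup 7F
pattern initAbove   = setup 8F

pattern loop i      = inj₂ (inj₂ (inj₁ i))
pattern stage       = loop 0F
pattern targLoop    = loop 1F
pattern startRound  = loop 2F
pattern destLoop    = loop 3F
pattern startWalk   = loop 4F
pattern incDest     = loop 5F
pattern checkSum    = loop 6F
pattern checkCnt    = loop 7F
pattern checkHits   = loop 8F
pattern incTarg     = loop 9F

pattern finale i    = inj₂ (inj₂ (inj₂ (inj₁ i)))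
pattern incAbove    = finale 0F
pattern incWeight   = finale 1F
pattern endStage    = finale 2F
pattern advance     = finale 3F
pattern incRank     = finale 4F
pattern checkWeight = finale 5F
pattern printRank   = finale 6F
pattern done        = finale 7F

pattern walking i   = inj₂ (inj₂ (inj₂ (inj₂ (inj₁ i))))
pattern walk        = walking 0F
pattern scanRow     = walking 1F
pattern incCol      = walking 2F
pattern take        = walking 3F
pattern incLen      = walking 4F
pattern incSum      = walking 5F
pattern arrive      = walking 6F
pattern incCnt      = walking 7F
pattern testCol     = walking 8F
pattern moveCol     = walking 9F

pattern testing i   = inj₂ (inj₂ (inj₂ (inj₂ (inj₂ i))))
pattern countCol    = testing 0F
pattern readEntry   = testing 1F
pattern incHits     = testing 2F

record Regs : Set where
  field
    size src goal           : ℕ  -- number of vertices, the source, the guessed sum of all levels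
    rank above above′       : ℕ  -- k, and the number of vertices of level ≥ k and ≥ k + 1
    weight                  : ℕ  -- the sum of min (level, k)
    targ dest curr len      : ℕ  -- v, u, and the end and length of a path that should reach u
    col row                 : ℕ
    sum cnt hits            : ℕ  -- totals over the vertices u examined so far

open Regs

-- The leading 0 is a constant that the program never overwrites: clearing a register is a copy of
-- it, and a test for zero is a comparison with it. With concrete indices the vector updates in the
-- rules compute to record updates.
registers : Regs → Vec ℕ 17
registers r = 0 ∷ size r ∷ src r ∷ goal r ∷ rank r ∷ above r ∷ above′ r ∷ weight r ∷ targ r ∷
  dest r ∷ curr r ∷ len r ∷ col r ∷ row r ∷ sum r ∷ cnt r ∷ hits r ∷ []

Reg : Set
Reg = Fin 17

zeroᴿ sizeᴿ srcᴿ goalᴿ rankᴿ aboveᴿ above′ᴿ weightᴿ targᴿ destᴿ currᴿ lenᴿ colᴿ rowᴿ sumᴿ cntᴿ hitsᴿ : Reg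
zeroᴿ   = Fin.# 0
sizeᴿ   = Fin.# 1
srcᴿ    = Fin.# 2
goalᴿ   = Fin.# 3
rankᴿ   = Fin.# 4
aboveᴿ  = Fin.# 5
above′ᴿ = Fin.# 6
weightᴿ = Fin.# 7
targᴿ   = Fin.# 8
destᴿ   = Fin.# 9
currᴿ   = Fin.# 10
lenᴿ    = Fin.# 11
colᴿ    = Fin.# 12
rowᴿ    = Fin.# 13
sumᴿ    = Fin.# 14
cntᴿ    = Fin.# 15
hitsᴿ   = Fin.# 16

Branch : Set
Branch = Scanned Symbol → List (Move × Lab)

rewinding skipping : Lab → Lab → Branch
rewinding again next ⊢ = (right , next) ∷ []
rewinding again next _ = (left , again) ∷ []

skipping again next (symbol (bit _)) = (right , again) ∷ []
skipping again next (symbol #)       = (right , next) ∷ []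
skipping again next _                = []

readingSrc readingRow choosing scanning readingEntry : Branch
readingSrc (symbol (bit _)) = (right , incSrc) ∷ []
readingSrc (symbol #)       = (right , skipSink₀) ∷ []
readingSrc _                = []

readingRow (symbol (bit _)) = (right , incSize) ∷ []
readingRow (symbol #)       = (stay , guess) ∷ []
readingRow _                = []

-- The sum is guessed in unary, by stopping or adding one, so each value is reached along exactly
-- one computation path.
choosing _ = (stay , initAbove) ∷ (stay , incGoal) ∷ []

-- Every 1 in the row offers to take this edge or to look further, and running past the row rejects.
-- Each edge thus corresponds to one sequence of choices.
scanning (symbol (bit true))  = (stay , take) ∷ (right , incCol) ∷ []
scanning (symbol (bit false)) = (right , incCol) ∷ []
scanning _                    = []

readingEntry (symbol (bit true))  = (stay , incHits) ∷ []
readingEntry (symbol (bit false)) = (stay , incDest) ∷ []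
readingEntry _                    = []

found : Bool → Lab
found false = scanRow
found true  = testCol

increment : Reg → Lab → Instr Symbol Lab 17
increment i q = sweep (inc i) nothing (just q)

assign : List (Reg × Reg) → Lab → Instr Symbol Lab 17
assign ps q = sweep (copy ps) nothing (just q)

prog : Lab → Instr Symbol Lab 17
prog (rewind σ)   = branch (rewinding (rewind σ) (skipSrc σ))
prog (skipSrc σ)  = branch (skipping (skipSrc σ) (skipSink σ))
prog (skipSink σ) = branch (skipping (skipSink σ) (clearRow σ))
prog (clearRow σ) = assign ((rowᴿ , zeroᴿ) ∷ (colᴿ , zeroᴿ) ∷ []) (testRow σ)
prog (testRow σ)  = sweep (eq rowᴿ currᴿ) (just (found σ)) (just (skipRow σ))
prog (skipRow σ)  = branch (skipping (skipRow σ) (countRow σ))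
prog (countRow σ) = increment rowᴿ (testRow σ)

prog begin₀       = branch (rewinding begin₀ readSrc)
prog readSrc      = branch readingSrc
prog incSrc       = increment srcᴿ readSrc
prog skipSink₀    = branch (skipping skipSink₀ readRow)
prog readRow      = branch readingRow
prog incSize      = increment sizeᴿ readRow
prog guess        = branch choosing
prog incGoal      = increment goalᴿ guess
prog initAbove    = assign ((aboveᴿ , sizeᴿ) ∷ []) stage

prog stage        = assign ((above′ᴿ , zeroᴿ) ∷ (targᴿ , zeroᴿ) ∷ []) targLoop
prog targLoop     = sweep (eq targᴿ sizeᴿ) (just endStage) (just startRound)
prog startRound   = assign ((sumᴿ , zeroᴿ) ∷ (cntᴿ , zeroᴿ) ∷ (hitsᴿ , zeroᴿ) ∷ (destᴿ , zeroᴿ) ∷ []) destLoop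
prog destLoop     = sweep (eq destᴿ sizeᴿ) (just checkSum) (just startWalk)
prog startWalk    = assign ((currᴿ , srcᴿ) ∷ (lenᴿ , zeroᴿ) ∷ []) walk
prog incDest      = increment destᴿ destLoop
prog checkSum     = sweep (eq sumᴿ goalᴿ) (just checkCnt) nothing
prog checkCnt     = sweep (eq cntᴿ aboveᴿ) (just checkHits) nothing
prog checkHits    = sweep (eq hitsᴿ zeroᴿ) (just incTarg) (just incAbove)
prog incTarg      = increment targᴿ targLoop

prog incAbove     = increment above′ᴿ incWeight
prog incWeight    = increment weightᴿ incTarg
prog endStage     = sweep (eq above′ᴿ zeroᴿ) (just checkWeight) (just advance)
prog advance      = assign ((aboveᴿ , above′ᴿ) ∷ []) incRank
prog incRank      = increment rankᴿ stage
prog checkWeight  = sweep (eq weightᴿ goalᴿ) (just printRank) nothing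
prog printRank    = sweep (print rankᴿ) nothing (just done)
prog done         = halt

prog walk         = sweep (eq currᴿ destᴿ) (just arrive) (just (rewind false))
prog scanRow      = branch scanning
prog incCol       = increment colᴿ scanRow
prog take         = assign ((currᴿ , colᴿ) ∷ []) incLen
prog incLen       = increment lenᴿ incSum
prog incSum       = increment sumᴿ walk
prog arrive       = sweep (le rankᴿ lenᴿ) (just incCnt) (just incDest)
prog incCnt       = increment cntᴿ (rewind true)
prog testCol      = sweep (eq colᴿ targᴿ) (just readEntry) (just moveCol)
-- With both labels equal, `skipping` is a single move to the right.
prog moveCol      = branch (skipping countCol countCol)
prog countCol     = increment colᴿ testCol
prog readEntry    = branch readingEntry
prog incHits      = increment hitsᴿ incDest

-- `col` can double as the clock, since `clearRow` resets it before the program first reads it.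
open Machine Lab-finite prog begin₀ colᴿ using (machine; logSpace; module Rules; module Start)

-- Reading the encoded graph.

module Subroutines (w : List Symbol) (P : List Bit → Set) (L : ℕ) where

  open Rules w P
  open Outcome machine w P

  at : Lab → ℕ → Regs → Bool → Set
  at q h r o = At L q h (registers r) o

  Reads : ℕ → List Symbol → Set
  Reads h suf = ∃[ i ] h ≡ suc i × drop i w ≡ suf

  reads-scan : ∀ {h a suf} → Reads h (a ∷ suf) → scan w h ≡ symbol a
  reads-scan (i , refl , e) rewrite e = refl

  reads-right : ∀ {h a suf} → Reads h (a ∷ suf) → Reads (moveInput w right h) suf
  reads-right (i , refl , e) = suc i , cong suc (m≤n⇒m⊓n≡m (proj₂ (go w i e))) , proj₁ (go w i e)
    where
    go : ∀ v i {a suf} → drop i v ≡ a ∷ suf → drop (suc i) v ≡ suf × i < length v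
    go (_ ∷ v) zero    refl = refl , s≤s z≤n
    go (_ ∷ v) (suc i) e    = let (d , l) = go v i e in d , s≤s l

  rewind-rule : ∀ {q q′ r o} → prog q ≡ branch (rewinding q q′) →
    (∀ h → Reads h w → at q′ h r o) → ∀ h → at q h r o
  rewind-rule {q} {q′} is k zero    = move-rule is refl (k _ (0 , refl , refl))
  rewind-rule {q} {q′} is k (suc i) = move-rule is (inside (head (drop i w))) (rewind-rule is k i)
    where
    inside : ∀ m → rewinding q q′ (maybe symbol ⊣ m) ≡ (left , q) ∷ []
    inside (just _) = refl
    inside nothing  = refl

  IsBit : Symbol → Set
  IsBit a = ∃[ b ] a ≡ bit b

  skip-rule : ∀ {q q′ r o suf xs} → prog q ≡ branch (skipping q q′) → All IsBit xs →
    (∀ h → Reads h suf → at q′ h r o) → ∀ h → Reads h (xs ++ # ∷ suf) → at q h r o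
  skip-rule {q} {q′} is []                k h reads = move-rule is (cong (skipping q q′) (reads-scan reads)) (k _ (reads-right reads))
  skip-rule {q} {q′} is ((_ , refl) ∷ ps) k h reads = move-rule is (cong (skipping q q′) (reads-scan reads)) (skip-rule is ps k _ (reads-right reads))

  bits : ∀ {m} → (Fin m → Bool) → List Symbol
  bits f = tabulate (bit ∘ f)

  bits-IsBit : ∀ {m} (f : Fin m → Bool) → All IsBit (bits f)
  bits-IsBit {zero}  f = []
  bits-IsBit {suc m} f = (f zero , refl) ∷ bits-IsBit (f ∘ suc)

  rowLines : ∀ {m k} → (Fin m → Fin k → Bool) → List Symbol
  rowLines f = concat (tabulate λ i → bits (f i) ++ # ∷ [])

  rowLines-suc : ∀ {m k} (f : Fin (suc m) → Fin k → Bool) →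
    rowLines f ≡ bits (f zero) ++ # ∷ rowLines (f ∘ suc)
  rowLines-suc f = ++-assoc (bits (f zero)) (# ∷ []) _

  -- Here `f` stands for the rows from the head onwards and `row` counts those passed. The
  -- continuation is quantified over the final values of scratch registers, which therefore never
  -- have to be computed; the other subroutines follow the same style.
  seek-loop : ∀ {m k} σ {r o} (f : Fin m → Fin k → Bool) x → curr r ≡ row r + toℕ x → curr r < 2 ^ L →
    (∀ h z suf → Reads h (bits (f x) ++ # ∷ suf) → at (found σ) h (record r { row = z }) o) →
    ∀ h → Reads h (rowLines f) → at (testRow σ) h r o
  seek-loop σ {r} f zero e _ k h reads = eq-rule refl
    (λ _ → k h (row r) _ (subst (Reads h) (rowLines-suc f) reads))
    (λ ne → contradiction (sym (trans e (+-identityʳ _))) ne)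
  seek-loop σ {r} f (suc x) e small k h reads = eq-rule refl
    (λ e′ → contradiction (trans (sym e) (sym e′)) (m+1+n≢m (row r)))
    (λ _ → skip-rule refl (bits-IsBit (f zero))
      (λ h′ reads′ → inc-rule refl
        (λ _ → ≤-trans (s≤s (s≤s (m≤m+n (row r) (toℕ x)))) (≤-trans (≤-reflexive (cong suc (sym e′))) small))
        (λ _ → seek-loop σ (f ∘ suc) x e′ small k h′ reads′))
      h (subst (Reads h) (rowLines-suc f) reads))
    where
    e′ : curr r ≡ suc (row r) + toℕ x
    e′ = trans e (+-suc (row r) (toℕ x))

  column-loop : ∀ {m r o} (f : Fin m → Bool) i {suf} → targ r ≡ col r + toℕ i → targ r < 2 ^ L →
    (∀ h y suf′ → Reads h (bit (f i) ∷ suf′) → at readEntry h (record r { col = y }) o) →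
    ∀ h → Reads h (bits f ++ suf) → at testCol h r o
  column-loop {r = r} f zero e _ k h reads = eq-rule refl
    (λ _ → k h (col r) _ reads)
    (λ ne → contradiction (sym (trans e (+-identityʳ _))) ne)
  column-loop {r = r} f (suc i) e small k h reads = eq-rule refl
    (λ e′ → contradiction (trans (sym e) (sym e′)) (m+1+n≢m (col r)))
    (λ _ → move-rule refl (cong (skipping countCol countCol) (reads-scan reads)) (inc-rule refl
      (λ _ → ≤-trans (s≤s (s≤s (m≤m+n (col r) (toℕ i)))) (≤-trans (≤-reflexive (cong suc (sym e′))) small))
      (λ _ → column-loop (f ∘ suc) i e′ small k _ (reads-right reads))))
    where
    e′ : targ r ≡ suc (col r) + toℕ i
    e′ = trans e (+-suc (col r) (toℕ i))

  -- Each edge taken rejects by assumption, and declining all of them ends at the row terminator,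
  -- where the machine is stuck.
  scan-dead : ∀ {m r} (f : Fin m → Bool) {suf} →
    (∀ i h y → T (f i) → y ≡ col r + toℕ i → at take h (record r { col = y }) false) →
    ∀ h → Reads h (bits f ++ # ∷ suf) → at scanRow h r false
  scan-dead {zero} f k h reads = stuck-rule refl (cong scanning (reads-scan reads)) refl
  scan-dead {suc m} {r} f k h reads = by-bit (f zero) refl
    where
    rest : ∀ {h} → Reads h (bit (f zero) ∷ bits (f ∘ suc) ++ # ∷ _) → at incCol (moveInput w right h) r false
    rest reads = inc-rule refl (λ ()) (λ _ →
      scan-dead (f ∘ suc) (λ i h y t e → k (suc i) h y t (trans e (sym (+-suc (col r) (toℕ i))))) _ (reads-right reads))

    by-bit : ∀ b → f zero ≡ b → at scanRow h r false
    by-bit true  e = fork-false-rule refl (cong scanning (trans (reads-scan reads) (cong (symbol ∘ bit) e)))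
      (k zero h (col r) (subst T (sym e) tt) (sym (+-identityʳ _))) (rest reads)
    by-bit false e = move-rule refl (cong scanning (trans (reads-scan reads) (cong (symbol ∘ bit) e))) (rest reads)

  scan-live : ∀ {m r} (f : Fin m → Bool) {suf} i₀ → T (f i₀) → col r + toℕ i₀ < 2 ^ L →
    (∀ h y → y ≡ col r + toℕ i₀ → at take h (record r { col = y }) true) →
    (∀ i h y → i ≢ i₀ → T (f i) → y ≡ col r + toℕ i → at take h (record r { col = y }) false) →
    ∀ h → Reads h (bits f ++ # ∷ suf) → at scanRow h r true
  scan-live {suc m} {r} f zero t small yes′ no′ h reads = by-bit (f zero) refl t
    where
    by-bit : ∀ b → f zero ≡ b → T b → at scanRow h r true
    by-bit true e _ = fork-left-rule refl (cong scanning (trans (reads-scan reads) (cong (symbol ∘ bit) e)))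
      (yes′ h (col r) (sym (+-identityʳ _)))
      (inc-rule refl (λ ()) (λ _ → scan-dead (f ∘ suc)
        (λ i h y t e → no′ (suc i) h y (λ ()) t (trans e (sym (+-suc (col r) (toℕ i))))) _ (reads-right reads)))
  scan-live {suc m} {r} f (suc i₀) t small yes′ no′ h reads = by-bit (f zero) refl
    where
    small′ : suc (col r) + toℕ i₀ < 2 ^ L
    small′ = ≤-trans (≤-reflexive (cong suc (sym (+-suc (col r) (toℕ i₀))))) small

    rest : at incCol (moveInput w right h) r true
    rest = inc-rule refl (λ _ → ≤-trans (s≤s (s≤s (m≤m+n (col r) (toℕ i₀)))) small′) (λ _ →
      scan-live (f ∘ suc) i₀ t small′
        (λ h y e → yes′ h y (trans e (sym (+-suc (col r) (toℕ i₀)))))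
        (λ i h y i≢ t e → no′ (suc i) h y (λ { refl → i≢ refl }) t (trans e (sym (+-suc (col r) (toℕ i)))))
        _ (reads-right reads))

    by-bit : ∀ b → f zero ≡ b → at scanRow h r true
    by-bit true  e = fork-right-rule refl (cong scanning (trans (reads-scan reads) (cong (symbol ∘ bit) e)))
      (no′ zero h (col r) (λ ()) (subst T (sym e) tt) (sym (+-identityʳ _))) rest
    by-bit false e = move-rule refl (cong scanning (trans (reads-scan reads) (cong (symbol ∘ bit) e))) rest

  readSrc-rule : ∀ j {r o suf} → src r + j < 2 ^ L →
    (∀ h x → x ≡ src r + j → Reads h suf → at skipSink₀ h (record r { src = x }) o) →
    ∀ h → Reads h (List.replicate j (bit true) ++ # ∷ suf) → at readSrc h r o
  readSrc-rule zero    {r} small k h reads = move-rule refl (cong readingSrc (reads-scan reads))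
    (k _ (src r) (sym (+-identityʳ _)) (reads-right reads))
  readSrc-rule (suc j) {r} small k h reads = move-rule refl (cong readingSrc (reads-scan reads)) (inc-rule refl
    (λ _ → ≤-trans (s≤s (s≤s (m≤m+n (src r) j))) small′)
    (λ _ → readSrc-rule j small′ (λ h x e → k h x (trans e (sym (+-suc (src r) j)))) _ (reads-right reads)))
    where
    small′ : suc (src r) + j < 2 ^ L
    small′ = ≤-trans (≤-reflexive (cong suc (sym (+-suc (src r) j)))) small

  readRow-rule : ∀ {m} (f : Fin m → Bool) {r o suf} → size r + m < 2 ^ L →
    (∀ h x → x ≡ size r + m → at guess h (record r { size = x }) o) →
    ∀ h → Reads h (bits f ++ # ∷ suf) → at readRow h r o
  readRow-rule {zero}  f {r} small k h reads = move-rule refl (cong readingRow (reads-scan reads))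
    (k _ (size r) (sym (+-identityʳ _)))
  readRow-rule {suc m} f {r} small k h reads = move-rule refl (cong readingRow (reads-scan reads)) (inc-rule refl
    (λ _ → ≤-trans (s≤s (s≤s (m≤m+n (size r) m))) small′)
    (λ _ → readRow-rule (f ∘ suc) small′ (λ h x e → k h x (trans e (sym (+-suc (size r) m)))) _ (reads-right reads)))
    where
    small′ : suc (size r) + m < 2 ^ L
    small′ = ≤-trans (≤-reflexive (cong suc (sym (+-suc (size r) m)))) small

-- Correctness

digit-injective : ∀ {a b} → digit a ≡ digit b → a ≡ b
digit-injective {true}  {true}  _ = refl
digit-injective {false} {false} _ = refl

-- This turns a correct total of one-sided guesses into correctness of each guess, vertex by vertex.
+-tight : ∀ {a b c d} → a ≤ c → b ≤ d → a + b ≡ c + d → a ≡ c × b ≡ d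
+-tight {a} {b} {c} {d} a≤c b≤d e = a≡c , +-cancelˡ-≡ a b d (trans e (cong (_+ d) (sym a≡c)))
  where
  a≡c : a ≡ c
  a≡c = ≤-antisym a≤c (+-cancelʳ-≤ d c a (≤-trans (≤-reflexive (sym e)) (+-monoʳ-≤ a b≤d)))

module Correct {n : ℕ} (G : Digraph n) (s t : Fin n) (acyclic : Acyclic G)
  (source : IsUniqueSource G s) (sink : IsUniqueSink G t) (maxUnique : MaxUnique G)
  (L : ℕ) (large : suc (length (encode G s t)) < 2 ^ L) where

  open Paths G
  open Levels G s t acyclic source sink maxUnique

  w : List Symbol
  w = encode G s t

  Answer : List Bit → Set
  Answer out = IsLongestPathLength G s t (binaryValue out)

  open Subroutines w Answer L
  open Rules w Answer
  open Outcome machine w Answer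

  unary : Fin n → List Symbol
  unary v = List.replicate (toℕ v) (bit true)

  unary-IsBit : ∀ v → All IsBit (unary v)
  unary-IsBit v = go (toℕ v)
    where
    go : ∀ k → All IsBit (List.replicate k (bit true))
    go zero    = []
    go (suc k) = (true , refl) ∷ go k

  encode-split : w ≡ unary s ++ # ∷ (unary t ++ # ∷ rowLines G)
  encode-split = trans (++-assoc (unary s) (# ∷ []) _) (cong (λ v → unary s ++ # ∷ v) (++-assoc (unary t) (# ∷ []) _))

  -- The matrix has `n * n` entries, so a width that holds the input length also holds any sum of
  -- `n` levels.
  n*n<2^L : n * n < 2 ^ L
  n*n<2^L = ≤-trans (s≤s (begin
    n * n                          ≤⟨ rowLines-length G ⟩
    length (rowLines G)            ≤⟨ suffix-length (unary t) ⟩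
    length (unary t ++ # ∷ rowLines G) ≤⟨ suffix-length (unary s) ⟩
    length (unary s ++ # ∷ (unary t ++ # ∷ rowLines G)) ≡⟨ cong length (sym encode-split) ⟩
    length w                       ∎)) (≤-trans (n≤1+n _) large)
    where
    open ≤-Reasoning
    suffix-length : ∀ (xs : List Symbol) {x ys} → length ys ≤ length (xs ++ x ∷ ys)
    suffix-length xs {x} {ys} = ≤-trans (n≤1+n _) (≤-trans (m≤n+m _ (length xs)) (≤-reflexive (sym (length-++ xs))))
    rowLines-length : ∀ {m k} (f : Fin m → Fin k → Bool) → m * k ≤ length (rowLines f)
    rowLines-length {zero}      f = z≤n
    rowLines-length {suc m} {k} f = begin
      k + m * k                                       ≤⟨ +-mono-≤ (≤-reflexive (sym (length-tabulate (bit ∘ f zero)))) (≤-trans (rowLines-length (f ∘ suc)) (n≤1+n _)) ⟩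
      length (bits (f zero)) + length (# ∷ rowLines (f ∘ suc)) ≡⟨ sym (length-++ (bits (f zero))) ⟩
      length (bits (f zero) ++ # ∷ rowLines (f ∘ suc)) ≡⟨ cong length (sym (rowLines-suc f)) ⟩
      length (rowLines f)                             ∎

  n<2^L : n < 2 ^ L
  n<2^L = ≤-trans (s≤s (n≤n*n s)) n*n<2^L
    where
    n≤n*n : ∀ {n} → Fin n → n ≤ n * n
    n≤n*n {suc n} _ = m≤m*n (suc n) (suc n)

  vertex<2^L : ∀ (x : Fin n) → toℕ x < 2 ^ L
  vertex<2^L x = <-trans (toℕ<n x) n<2^L

  seek-rule : ∀ σ {r o} x → curr r ≡ toℕ x →
    (∀ h z suf → Reads h (bits (G x) ++ # ∷ suf) → at (found σ) h (record r { row = z ; col = 0 }) o) →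
    ∀ h → at (rewind σ) h r o
  seek-rule σ {r} {o} x e k = rewind-rule refl λ h reads →
    skip-rule refl (unary-IsBit s) (skip-rule refl (unary-IsBit t) (λ h reads →
      copy-rule refl (seek-loop σ G x e (subst (_< 2 ^ L) (sym e) (vertex<2^L x)) k h reads)))
      h (subst (Reads h) encode-split reads)

  -- Three control flows meet at `incDest`: the length is below the rank, or it is not and the edge
  -- to `v` is absent or present. Writing the increments as digits gives them a common continuation.
  arrive-rule : ∀ {r o} u v → curr r ≡ toℕ u → targ r ≡ toℕ v →
    (T o → suc (cnt r) < 2 ^ L × suc (hits r) < 2 ^ L) →
    (∀ h y z c f → c ≡ cnt r + digit (rank r ≤ᵇ len r) → f ≡ hits r + digit ((rank r ≤ᵇ len r) ∧ G u v) →
      at incDest h (record r { col = y ; row = z ; cnt = c ; hits = f }) o) →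
    ∀ h → at arrive h r o
  arrive-rule {r} {o} u v ecurr etarg bound k h = le-rule refl
    (λ k≤l → inc-rule refl (λ live → proj₁ (bound live)) (λ _ →
      seek-rule true u ecurr (λ h z suf reads →
        column-loop (G u) v etarg (subst (_< 2 ^ L) (sym etarg) (vertex<2^L v))
          (λ h y suf′ reads′ → entry (Equivalence.to T-≡ (≤⇒≤ᵇ k≤l)) (G u v) refl h y z reads′) h reads) h))
    (λ l<k → k h (col r) (row r) (cnt r) (hits r)
      (trans (sym (+-identityʳ _)) (cong (λ b → cnt r + digit b) (sym (below l<k))))
      (trans (sym (+-identityʳ _)) (cong (λ b → hits r + digit (b ∧ G u v)) (sym (below l<k)))))
    where
    below : len r < rank r → (rank r ≤ᵇ len r) ≡ false
    below l<k = ¬T⇒≡ (λ k≤l → <⇒≱ l<k (≤ᵇ⇒≤ _ _ k≤l))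
    entry : (rank r ≤ᵇ len r) ≡ true → ∀ b → G u v ≡ b → ∀ h y z {suf} → Reads h (bit (G u v) ∷ suf) →
      at readEntry h (record r { col = y ; row = z ; cnt = suc (cnt r) }) o
    entry k≤l b e h y z reads = by-entry b e
      where
      c≡ : suc (cnt r) ≡ cnt r + digit (rank r ≤ᵇ len r)
      c≡ = trans (+-comm 1 (cnt r)) (cong (λ b → cnt r + digit b) (sym k≤l))
      scanned : ∀ {b} → G u v ≡ b → readingEntry (scan w h) ≡ readingEntry (symbol (bit b))
      scanned e = cong readingEntry (trans (reads-scan reads) (cong (symbol ∘ bit) e))
      by-entry : ∀ b → G u v ≡ b → at readEntry h (record r { col = y ; row = z ; cnt = suc (cnt r) }) o
      by-entry true e = move-rule refl (scanned e) (inc-rule refl (λ live → proj₂ (bound live)) (λ _ →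
        k _ y z _ _ c≡ (trans (+-comm 1 (hits r)) (cong₂ (λ a b → hits r + digit (a ∧ b)) (sym k≤l) (sym e)))))
      by-entry false e = move-rule refl (scanned e)
        (k _ y z _ _ c≡ (trans (sym (+-identityʳ _)) (cong₂ (λ a b → hits r + digit (a ∧ b)) (sym k≤l) (sym e))))

  -- Here `d` is the number of edges still to be walked. The new values are variables with
  -- equations, so that callers supply arithmetic in place of rewriting a record.
  Arrives : Regs → Fin n → ℕ → Bool → Set
  Arrives r u d o = ∀ h c l m y z → c ≡ toℕ u → l ≡ len r + d → m ≡ sum r + d →
    at arrive h (record r { curr = c ; len = l ; sum = m ; col = y ; row = z }) o

  arrives-cons : ∀ {r u d o} → Arrives r u (suc d) o →
    Arrives (record r { len = suc (len r) ; sum = suc (sum r) }) u d o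
  arrives-cons {r} {d = d} k h c l m y z ec el em =
    k h c l m y z ec (trans el (sym (+-suc (len r) d))) (trans em (sym (+-suc (sum r) d)))

  -- Induction along edges, which cannot be followed forever in an acyclic graph. Every walk that
  -- does reach `u` is some path `q`, for which rejection is assumed.
  walk-dead : ∀ {u} x → Acc (flip (Edge G)) x → ∀ {r} → curr r ≡ toℕ x → dest r ≡ toℕ u →
    (∀ (q : Path G x u) → Arrives r u (pathLength G q) false) → ∀ h → at walk h r false
  walk-dead {u} x (acc rec) {r} ecurr edest k h = eq-rule refl
    (λ e → reached (toℕ-injective (trans (sym ecurr) (trans e edest))) k)
    (λ _ → seek-rule false x ecurr (λ h z suf reads → scan-dead (G x)
      (λ y h c edge e → copy-rule refl (inc-rule refl (λ ()) (λ _ → inc-rule refl (λ ()) (λ _ →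
        walk-dead y (rec edge) e edest (λ q → arrives-cons {r} (k (edge ◅ q))) h))))
      h reads) h)
    where
    reached : x ≡ u → (∀ (q : Path G x u) → Arrives r u (pathLength G q) false) → at arrive h r false
    reached refl k = k ε h (curr r) (len r) (sum r) (col r) (row r) ecurr (sym (+-identityʳ _)) (sym (+-identityʳ _))

  -- The walk follows `p`. At the first edge that deviates, all completions are paths different from
  -- `p`, so `walk-dead` applies.
  walk-live : ∀ {u x} (p : Path G x u) → ∀ {r} → curr r ≡ toℕ x → dest r ≡ toℕ u →
    len r + pathLength G p < 2 ^ L → sum r + pathLength G p < 2 ^ L →
    Arrives r u (pathLength G p) true →
    (∀ (q : Path G x u) → q ≢ p → Arrives r u (pathLength G q) false) → ∀ h → at walk h r true
  walk-live ε {r} ecurr edest _ _ yes′ _ h = eq-rule refl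
    (λ _ → yes′ h (curr r) (len r) (sum r) (col r) (row r) ecurr (sym (+-identityʳ _)) (sym (+-identityʳ _)))
    (λ ne → contradiction (trans ecurr (sym edest)) ne)
  walk-live {u} {x} (_◅_ {j = x′} edge p) {r} ecurr edest small-len small-sum yes′ no′ h = eq-rule refl
    -- The machine stops as soon as it meets `u`; acyclicity ensures that this does not happen
    -- before `p` is used up.
    (λ e → contradiction (closed (toℕ-injective (trans (sym ecurr) (trans e edest)))) λ ())
    (λ _ → seek-rule false x ecurr (λ h z suf reads → scan-live (G x) x′ edge (vertex<2^L x′)
      (λ h c e → copy-rule refl
        (inc-rule refl (λ _ → ≤-trans (s≤s (s≤s (m≤m+n (len r) _))) small-len′) (λ _ →
        inc-rule refl (λ _ → ≤-trans (s≤s (s≤s (m≤m+n (sum r) _))) small-sum′) (λ _ →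
          walk-live p e edest small-len′ small-sum′ (arrives-cons {r} yes′)
            (λ q q≢p → arrives-cons {r} (no′ (edge ◅ q) (λ { refl → q≢p refl }))) h))))
      (λ y h c y≢x′ edge′ e → copy-rule refl (inc-rule refl (λ ()) (λ _ → inc-rule refl (λ ()) (λ _ →
        walk-dead y (edge-noetherian acyclic y) e edest
          (λ q → arrives-cons {r} (no′ (edge′ ◅ q) (λ { refl → y≢x′ refl }))) h))))
      h reads) h)
    where
    closed : x ≡ u → pathLength G (edge ◅ p) ≡ 0
    closed refl = cong (pathLength G) (loop-ε acyclic (edge ◅ p))
    small-len′ : suc (len r) + pathLength G p < 2 ^ L
    small-len′ = ≤-trans (≤-reflexive (cong suc (sym (+-suc (len r) _)))) small-len
    small-sum′ : suc (sum r) + pathLength G p < 2 ^ L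
    small-sum′ = ≤-trans (≤-reflexive (cong suc (sym (+-suc (sum r) _)))) small-sum

  module Round (r₀ : Regs) (k : ℕ) (v : Fin n) (esize : size r₀ ≡ n) (esrc : src r₀ ≡ toℕ s)
    (erank : rank r₀ ≡ k) (etarg : targ r₀ ≡ toℕ v) (eabove : above r₀ ≡ total (atLeast k)) where

    local : (d c l y z m a f : ℕ) → Regs
    local d c l y z m a f = record r₀
      { dest = d ; curr = c ; len = l ; col = y ; row = z ; sum = m ; cnt = a ; hits = f }

    visit : ∀ {u : Fin n} {c l y z m a f o} →
      (∀ h c → c ≡ toℕ s → at walk h (local (toℕ u) c 0 y z m a f) o) →
      ∀ h → at destLoop h (local (toℕ u) c l y z m a f) o
    visit {u} k h = eq-rule refl
      (λ e → contradiction (trans e esize) (<⇒≢ (toℕ<n u)))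
      (λ _ → copy-rule refl (k h (src r₀) esrc))

    vertex : ∀ {m j} → m + suc j ≡ n → ∃[ u ] toℕ {n} u ≡ m
    vertex {m} e = fromℕ< m<n , toℕ-fromℕ< m<n
      where
      m<n : m < n
      m<n = ≤-trans (s≤s (m≤m+n m _)) (≤-reflexive (trans (sym (+-suc m _)) e))

    finished : ∀ {m} → m + 0 ≡ n → m ≡ n
    finished = trans (sym (+-identityʳ _))

    final : ∀ {c l y z m a f o} →
      (m ≡ goal r₀ → a ≡ above r₀ → ∀ h → at checkHits h (local n c l y z m a f) o) →
      (m ≢ goal r₀ ⊎ a ≢ above r₀ → o ≡ false) →
      ∀ h → at destLoop h (local n c l y z m a f) o
    final yes′ no′ h = eq-rule refl
      (λ _ → eq-rule refl
        (λ em → eq-rule refl (λ ea → yes′ em ea h) (λ ne → no′ (inj₂ ne)))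
        (λ ne → no′ (inj₁ ne)))
      (λ ne → contradiction (sym esize) ne)

    Exits : Bool → Set
    Exits o = ∀ h d c l y z m a f → f ≡ total (predecessorAtLeast k v) → at checkHits h (local d c l y z m a f) o

    cnt-rank : ∀ x {a l l′} → l ≡ l′ → a ≡ x + digit (rank r₀ ≤ᵇ l) → a ≡ x + digit (k ≤ᵇ l′)
    cnt-rank x refl e = trans e (cong (λ k → x + digit (k ≤ᵇ _)) erank)

    hits-rank : ∀ x {f l l′ b} → l ≡ l′ → f ≡ x + digit ((rank r₀ ≤ᵇ l) ∧ b) → f ≡ x + digit ((k ≤ᵇ l′) ∧ b)
    hits-rank x refl e = trans e (cong (λ k → x + digit ((k ≤ᵇ _) ∧ _)) erank)

    -- A length guessed too short can never be made up for, as the guessed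
    -- lengths have to add up to the sum of all levels.
    short : goal r₀ ≡ total level → ∀ j m → m + j ≡ n → ∀ {c l y z σ a f} →
      σ < prefix m level → ∀ h → at destLoop h (local m c l y z σ a f) false
    short egoal zero m e σ< h with refl ← finished e =
      final (λ eσ _ → contradiction (trans eσ egoal) (<⇒≢ σ<)) (λ _ → refl) h
    short egoal (suc j) m e {σ = σ} σ< h with u , refl ← vertex e =
      visit (λ h c ec → walk-dead s (edge-noetherian acyclic s) ec refl
        (λ q h c l σ′ y z ec el eσ → arrive-rule u v ec etarg (λ ())
          (λ h y z a f _ _ → inc-rule refl (λ ()) (λ _ →
            short egoal j (suc (toℕ u)) (trans (sym (+-suc (toℕ u) j)) e)
              (subst₂ _<_ (sym eσ) (sym (prefix-suc level u)) (+-mono-<-≤ σ< (longest-isLongest u q))) h)) h) h) h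

    -- The guesses can only underestimate, so `cnt` never exceeds the true partial count. If it
    -- equals that count, each threshold verdict so far was right, and so is `hits`. Passing
    -- `checkCnt` thus guarantees `hits` whatever the guessed sum is.
    dead : Exits false → ∀ j m → m + j ≡ n → ∀ {c l y z σ a f} →
      a ≤ prefix m (atLeast k) →
      (a ≡ prefix m (atLeast k) → f ≡ prefix m (predecessorAtLeast k v)) →
      ∀ h → at destLoop h (local m c l y z σ a f) false
    dead exit zero m e a≤ f≡ h with refl ← finished e =
      final (λ _ ea h → exit h _ _ _ _ _ _ _ _ (f≡ (trans ea eabove))) (λ _ → refl) h
    dead exit (suc j) m e {a = a} {f} a≤ f≡ h with u , refl ← vertex e =
      visit (λ h c ec → walk-dead s (edge-noetherian acyclic s) ec refl
        (λ q h c l σ′ y z ec el eσ → arrive-rule u v ec etarg (λ ())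
          (λ h y z a′ f′ ea ef → inc-rule refl (λ ()) (λ _ →
            dead exit j (suc (toℕ u)) (trans (sym (+-suc (toℕ u) j)) e)
              (subst₂ _≤_ (sym (cnt-rank a el ea)) (sym (prefix-suc (atLeast k) u)) (+-mono-≤ a≤ (guessed≤ q)))
              (λ a′≡total →
                let a≡ , d≡ = +-tight a≤ (guessed≤ q) (trans (sym (cnt-rank a el ea)) (trans a′≡total (prefix-suc (atLeast k) u)))
                in trans (hits-rank f el ef) (trans
                     (cong₂ (λ x b → x + digit (b ∧ G u v)) (f≡ a≡) (digit-injective d≡))
                     (sym (prefix-suc (predecessorAtLeast k v) u))))
              h)) h) h) h
      where
      guessed≤ : ∀ {u} (q : Path G s u) → digit (k ≤ᵇ pathLength G q) ≤ atLeast k u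
      guessed≤ {u} q = digit-mono (λ k≤ → ≤⇒≤ᵇ (≤-trans (≤ᵇ⇒≤ k _ k≤) (longest-isLongest u q)))

    -- All three totals are exact along the longest paths, so both checks succeed; the deviating
    -- branches are those that end in `short`.
    live : goal r₀ ≡ total level → Exits true → ∀ j m → m + j ≡ n → ∀ {c l y z σ a f} →
      σ ≡ prefix m level → a ≡ prefix m (atLeast k) → f ≡ prefix m (predecessorAtLeast k v) →
      ∀ h → at destLoop h (local m c l y z σ a f) true
    live egoal exit zero m e eσ ea ef h with refl ← finished e =
      final (λ _ _ h → exit h _ _ _ _ _ _ _ _ ef)
        (λ where (inj₁ ne) → contradiction (trans eσ (sym egoal)) ne
                 (inj₂ ne) → contradiction (trans ea (sym eabove)) ne) h
    live egoal exit (suc j) m e {σ = σ} {a} {f} refl refl refl h with u , refl ← vertex e =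
      visit (λ h c ec → walk-live (longest u) ec refl
        (<-trans (level<n u) n<2^L) (small-sum u)
        (λ h c l σ′ y z ec el eσ → arrive-rule u v ec etarg
          (λ _ → suc-small u (prefix≤ _ (atLeast≤1 k)) , suc-small u (prefix≤ _ (predecessorAtLeast≤1 k v)))
          (λ h y z a′ f′ ea ef → inc-rule refl (λ _ → suc-small u ≤-refl) (λ _ →
            live egoal exit j (suc (toℕ u)) (trans (sym (+-suc (toℕ u) j)) e)
              (trans eσ (sym (prefix-suc level u)))
              (trans (cnt-rank _ el ea) (sym (prefix-suc (atLeast k) u)))
              (trans (hits-rank _ el ef) (sym (prefix-suc (predecessorAtLeast k v) u))) h)) h)
        -- By max-uniqueness any other path to `u` is strictly shorter, and this deficit in the sum
        -- is what `short` turns into rejection.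
        (λ q q≢ h c l σ′ y z ec el eσ → arrive-rule u v ec etarg (λ ())
          (λ h y z a f _ _ → inc-rule refl (λ ()) (λ _ →
            short egoal j (suc (toℕ u)) (trans (sym (+-suc (toℕ u) j)) e)
              (subst₂ _<_ (sym eσ) (sym (prefix-suc level u))
                (+-monoʳ-< _ (≰⇒> (λ l≤ → q≢ (sym (longest-unique u q l≤)))))) h)) h) h) h
      where
      suc-small : ∀ (u : Fin n) {x} → x ≤ toℕ u → suc x < 2 ^ L
      suc-small u x≤ = ≤-trans (s≤s (≤-trans (s≤s x≤) (toℕ<n u))) n<2^L
      small-sum : ∀ u → prefix (toℕ u) level + level u < 2 ^ L
      small-sum u = ≤-trans (s≤s (≤-trans (≤-reflexive (sym (prefix-suc level u))) (≤-trans (prefix≤total (suc (toℕ u)) level) total-level≤))) n*n<2^L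

    -- Whether the guessed sum of the levels is right matters only for
    -- having exactly one computation path.
    round : ∀ o → (T o → goal r₀ ≡ total level) → Exits o →
      ∀ h c l y z σ a f d → at startRound h (local d c l y z σ a f) o
    round false _    exit h _ _ _ _ _ _ _ _ = copy-rule refl (dead exit n 0 refl z≤n (λ _ → refl) h)
    round true  goal exit h _ _ _ _ _ _ _ _ = copy-rule refl (live (goal tt) exit n 0 refl refl refl refl h)

  -- `above′` and `weight` are raised for the same vertices, so over one stage `weight` passes from
  -- the sum truncated at `k` to the sum truncated at `suc k`.
  targets : ∀ o j m → m + j ≡ n → ∀ k {r} → (T o → goal r ≡ total level) →
    size r ≡ n → src r ≡ toℕ s → rank r ≡ k → above r ≡ total (atLeast k) →
    targ r ≡ m → above′ r ≡ prefix m (atLeast (suc k)) →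
    weight r ≡ total (truncated k) + prefix m (atLeast (suc k)) →
    (∀ h d c l y z σ a f v b u → b ≡ total (atLeast (suc k)) → u ≡ total (truncated (suc k)) →
      at endStage h (record r { targ = v ; above′ = b ; weight = u
        ; dest = d ; curr = c ; len = l ; col = y ; row = z ; sum = σ ; cnt = a ; hits = f }) o) →
    ∀ h → at targLoop h r o
  targets o zero m e k {r} egoal esize esrc erank eabove etarg eabove′ eweight exit h
    with refl ← trans (sym (+-identityʳ m)) e = eq-rule refl
      (λ _ → exit h _ _ _ _ _ _ _ _ (targ r) (above′ r) (weight r) eabove′ (trans eweight (sym (total-truncated-suc k))))
      (λ ne → contradiction (trans etarg (sym esize)) ne)
  targets o (suc j) m e k {r} egoal esize esrc erank eabove etarg eabove′ eweight exit h = eq-rule refl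
    (λ e′ → contradiction (trans (sym etarg) (trans e′ esize)) (<⇒≢ m<n))
    (λ _ → round o egoal (λ h d c l y z σ a f ef → eq-rule refl
      (λ f≡0 → following (predecessors-zero {k} {v} (trans (sym ef) f≡0)) h _ _ _ _ _ _ _ _ _ _
        (trans eabove′ (sym (+-identityʳ _))) (trans eweight (sym (+-identityʳ _))))
      (λ f≢0 → let one≡ = predecessors-nonzero {k} {v} (λ e → f≢0 (trans ef e)) in
        inc-rule refl (λ _ → above-small one≡) (λ _ → inc-rule refl (λ _ → weight-small one≡) (λ _ →
        following one≡ h _ _ _ _ _ _ _ _ _ _
          (trans (cong suc eabove′) (+-comm 1 _)) (trans (cong suc eweight) (+-comm 1 _))))))
      h _ _ _ _ _ _ _ _)
    where
    m<n : m < n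
    m<n = ≤-trans (s≤s (m≤m+n m j)) (≤-reflexive (trans (sym (+-suc m j)) e))

    v : Fin n
    v = fromℕ< m<n

    ev : toℕ v ≡ m
    ev = toℕ-fromℕ< m<n

    open Round r k v esize esrc erank (trans etarg (sym ev)) eabove using (round)

    prefix-next : ∀ {x} → atLeast (suc k) v ≡ x → prefix m (atLeast (suc k)) + x ≡ prefix (suc m) (atLeast (suc k))
    prefix-next refl = subst (λ m → prefix m (atLeast (suc k)) + atLeast (suc k) v ≡ prefix (suc m) (atLeast (suc k)))
      ev (sym (prefix-suc (atLeast (suc k)) v))

    above-small : atLeast (suc k) v ≡ 1 → suc (above′ r) < 2 ^ L
    above-small one≡ = ≤-trans (s≤s (begin
      suc (above′ r)                       ≡⟨ trans (cong suc eabove′) (+-comm 1 _) ⟩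
      prefix m (atLeast (suc k)) + 1       ≡⟨ prefix-next one≡ ⟩
      prefix (suc m) (atLeast (suc k))     ≤⟨ prefix≤total (suc m) (atLeast (suc k)) ⟩
      total (atLeast (suc k))              ≤⟨ prefix≤ n (atLeast≤1 (suc k)) ⟩
      n                                    ∎)) n<2^L
      where open ≤-Reasoning

    weight-small : atLeast (suc k) v ≡ 1 → suc (weight r) < 2 ^ L
    weight-small one≡ = ≤-trans (s≤s (begin
      suc (weight r)                       ≡⟨ trans (cong suc eweight) (trans (+-comm 1 _) (+-assoc (total (truncated k)) _ 1)) ⟩
      total (truncated k) + (prefix m (atLeast (suc k)) + 1) ≡⟨ cong (total (truncated k) +_) (prefix-next one≡) ⟩
      total (truncated k) + prefix (suc m) (atLeast (suc k)) ≤⟨ +-monoʳ-≤ (total (truncated k)) (prefix≤total (suc m) (atLeast (suc k))) ⟩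
      total (truncated k) + total (atLeast (suc k)) ≡⟨ sym (total-truncated-suc k) ⟩
      total (truncated (suc k))            ≤⟨ total-truncated≤ (suc k) ⟩
      total level                          ≤⟨ total-level≤ ⟩
      n * n                                ∎)) n*n<2^L
      where open ≤-Reasoning

    following : ∀ {x} → atLeast (suc k) v ≡ x → ∀ h d c l y z σ a f b u →
      b ≡ prefix m (atLeast (suc k)) + x → u ≡ total (truncated k) + prefix m (atLeast (suc k)) + x →
      at incTarg h (record r { above′ = b ; weight = u
        ; dest = d ; curr = c ; len = l ; col = y ; row = z ; sum = σ ; cnt = a ; hits = f }) o
    following {x} ex h _ _ _ _ _ _ _ _ b u eb eu = inc-rule refl
      (λ _ → ≤-trans (s≤s (≤-trans (s≤s (≤-reflexive etarg)) m<n)) n<2^L)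
      (λ _ → targets o j (suc m) (trans (sym (+-suc m j)) e) k egoal esize esrc erank eabove (cong suc etarg)
        (trans eb (prefix-next ex))
        (trans eu (trans (+-assoc (total (truncated k)) _ x) (cong (total (truncated k) +_) (prefix-next ex))))
        exit h)

  -- The two implications tie `o` to the correctness of the guessed sum: one supplies uniqueness in
  -- the rounds and success of the last check, the other shows that whoever passes the last check
  -- was entitled to. The induction is on the number `j` of levels left.
  stages : ∀ o j k → k + j ≡ level t → ∀ {r} →
    (T o → goal r ≡ total level) → (goal r ≡ total level → T o) →
    size r ≡ n → src r ≡ toℕ s → rank r ≡ k → above r ≡ total (atLeast k) →
    weight r ≡ total (truncated k) → ∀ h → at stage h r o
  stages o j k e {r} egoal goal⇒ esize esrc erank eabove eweight h = copy-rule refl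
    (targets o n 0 refl k egoal esize esrc erank eabove refl refl (trans eweight (sym (+-identityʳ _)))
      (λ h d c l y z σ a f v b u eb eu → eq-rule refl
        (λ b≡0 → eq-rule refl
          (λ u≡goal → output-rule (trans (sym eb) b≡0) o (goal⇒ (trans (sym u≡goal) (trans eu (top (trans (sym eb) b≡0))))) refl h)
          (λ u≢goal → ¬T⇒≡ (λ live → u≢goal (trans eu (trans (top (trans (sym eb) b≡0)) (sym (egoal live)))))))
        (λ b≢0 → continue j e (top-not-reached (λ e → b≢0 (trans eb e))) eb eu))
      h)
    where
    top : total (atLeast (suc k)) ≡ 0 → total (truncated (suc k)) ≡ total level
    top none = trans (total-truncated-suc k) (trans (cong (total (truncated k) +_) none) (trans (+-identityʳ _) (total-truncated-top none)))

    -- `k + j` being the level of `t` gives one inequality for the printed rank, and emptiness of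
    -- the next stage gives the other.
    output-rule : total (atLeast (suc k)) ≡ 0 → ∀ o → T o → ∀ {r′} → rank r′ ≡ rank r → ∀ h → at printRank h r′ o
    output-rule none true _ er h = print-rule refl refl
      (λ out eout → subst (IsLongestPathLength G s t)
        (sym (trans eout (trans er (trans erank (≤-antisym (≤-trans (m≤m+n k j) (≤-reflexive e)) (top-reached none t))))))
        level-sink)

    continue : ∀ j → k + j ≡ level t → k < level t → ∀ {h d c l y z σ a f v b u} → b ≡ total (atLeast (suc k)) → u ≡ total (truncated (suc k)) →
      at advance h (record r { targ = v ; above′ = b ; weight = u
        ; dest = d ; curr = c ; len = l ; col = y ; row = z ; sum = σ ; cnt = a ; hits = f }) o
    continue zero    e k<  _  _  = contradiction (trans (sym (+-identityʳ k)) e) (<⇒≢ k<)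
    continue (suc j) e k< {h} eb eu = copy-rule refl (inc-rule refl
      (λ _ → ≤-trans (s≤s (≤-trans (s≤s (≤-reflexive erank)) (≤-trans k< (<⇒≤ (level<n t))))) n<2^L)
      (λ _ → stages o j (suc k) (trans (sym (+-suc k j)) e) egoal goal⇒ esize esrc (cong suc erank) eb eu h))

  start-stages : ∀ o {r} → (T o → goal r ≡ total level) → (goal r ≡ total level → T o) →
    size r ≡ n → src r ≡ toℕ s → rank r ≡ 0 → weight r ≡ 0 → ∀ h → at initAbove h r o
  start-stages o egoal goal⇒ esize esrc erank eweight h = copy-rule refl
    (stages o (level t) 0 refl egoal goal⇒ esize esrc erank (trans esize (sym total-atLeast-0))
      (trans eweight (sym total-truncated-0)) h)

  module Guess (r : Regs) (esize : size r ≡ n) (esrc : src r ≡ toℕ s)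
    (erank : rank r ≡ 0) (eweight : weight r ≡ 0) where

    guessed : ℕ → Regs
    guessed g = record r { goal = g }

    wrong : ∀ {g} → g ≢ total level → ∀ h → at initAbove h (guessed g) false
    wrong g≢ = start-stages false (λ ()) g≢ esize esrc erank eweight

    -- Only overflow ends the unary guess once it has passed the right value. The distance to
    -- `2 ^ L` bounds the remaining choices, and stopping at any of them is wrong.
    guess-high : ∀ j g → j + g ≡ 2 ^ L → total level < g → ∀ h → at guess h (guessed g) false
    guess-high zero    g e g> h = fork-false-rule refl refl (wrong (>⇒≢ g>) h)
      (inc-rule refl (λ ()) (λ g< → contradiction (≤-trans (n≤1+n _) g<) (<-irrefl e)))
    guess-high (suc j) g e g> h = fork-false-rule refl refl (wrong (>⇒≢ g>) h)
      (inc-rule refl (λ ()) (λ _ → guess-high j (suc g) (trans (+-suc j g) e) (≤-trans g> (n≤1+n g)) h))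

    total-level<2^L : total level < 2 ^ L
    total-level<2^L = ≤-trans (s≤s total-level≤) n*n<2^L

    -- Stopping early is wrong, stopping at the sum is right, and going beyond it is the case of
    -- `guess-high`.
    guess-low : ∀ j g → g + j ≡ total level → ∀ h → at guess h (guessed g) true
    guess-low zero g e h = fork-left-rule refl refl
      (start-stages true (λ _ → eg) (λ _ → tt) esize esrc erank eweight h)
      (inc-rule refl (λ ()) (λ g< → guess-high (2 ^ L ∸ suc g) (suc g) (m∸n+n≡m (<⇒≤ g<)) (s≤s (≤-reflexive (sym eg))) h))
      where
      eg : g ≡ total level
      eg = trans (sym (+-identityʳ g)) e
    guess-low (suc j) g e h = fork-right-rule refl refl
      (wrong (<⇒≢ g<) h)
      (inc-rule refl (λ _ → ≤-trans (s≤s g<) total-level<2^L) (λ _ → guess-low j (suc g) (trans (sym (+-suc g j)) e) h))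
      where
      g< : g < total level
      g< = ≤-trans (s≤s (m≤m+n g j)) (≤-reflexive (trans (sym (+-suc g j)) e))

  init : Regs
  init = record
    { size = 0 ; src = 0 ; goal = 0 ; rank = 0 ; above = 0 ; above′ = 0 ; weight = 0 ; targ = 0
    -- `col` is the clock, which the initial count has left at `suc (length w)`.
    ; dest = 0 ; curr = 0 ; len = 0 ; col = suc (length w) ; row = 0 ; sum = 0 ; cnt = 0 ; hits = 0 }

  begin-rule : ∀ h → at begin₀ h init true
  begin-rule = rewind-rule refl λ h reads →
    readSrc-rule (toℕ s) (vertex<2^L s) (λ h x ex reads →
      skip-rule refl (unary-IsBit t) (read-first G s ex) h reads)
      h (subst (Reads h) encode-split reads)
    where
    -- The number of vertices is obtained as the length of the first row; there is one because `s`
    -- is a vertex.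
    read-first : ∀ {m x} (f : Fin m → Fin n → Bool) → Fin m → x ≡ toℕ s →
      ∀ h → Reads h (rowLines f) → at readRow h (record init { src = x }) true
    read-first {suc m} f _ ex h reads = readRow-rule (f zero) n<2^L
      (λ h x′ ex′ → Guess.guess-low (record init { src = _ ; size = x′ }) ex′ ex refl refl (total level) 0 refl h)
      h (subst (Reads h) (rowLines-suc f) reads)

theorem10 : Σ[ M ∈ NTM Symbol Bit ]
    NTM.LogSpace M ×
    (∀ (n : ℕ) (G : Digraph n) (s t : Fin n) →
    Acyclic G → IsUniqueSource G s → IsUniqueSink G t → MaxUnique G →
    NTM.UnambiguouslyOutputs M (encode G s t)
    (λ out → IsLongestPathLength G s t (binaryValue out)))
-- `UnambiguouslyOutputs` is by definition `initial ⇓ true`, which is what `start-rule` yields.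
theorem10 = machine , logSpace , λ n G s t acyclic source sink maxUnique →
  Start.start-rule (encode G s t) _ (λ L large → Correct.begin-rule G s t acyclic source sink maxUnique L large _)
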